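{- Let $G$ be an $n$-vertex caterpillar with $r$ non-leaf vertices, where $r\le (n-6)/2$. Then $G$ is reconstructible from its deck $\mathcal D(G)$: every graph $H$ with $\mathcal D(H)=\mathcal D(G)$ is isomorphic to $G$.
   Context: A caterpillar is a tree in which the subgraph induced by the non-leaf vertices is a path (the spine). For an $n$-vertex graph $G$, the deck $\mathcal D(G)$ is the multiset of all induced subgraphs of $G$ (each up to isomorphism) having at most $(n+2)/2$ vertices. -}

module Defs where

open import Data.Nat using (ℕ; zero; suc; _+_; _*_; _≤_)
open import Data.Nat.Properties using (_≟_)
open import Data.Bool using (Bool; true; false; not)
open import Data.Fin using (Fin; toℕ; inject₁; fromℕ) renaming (zero to fzero; suc to fsuc)
open import Data.Fin.Subset using (Subset; ∣_∣)
open import Data.Vec using (Vec; lookup; tabulate)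
open import Data.Product using (Σ; ∃; _×_; _,_; proj₁; proj₂)
open import Data.Sum using (_⊎_)
open import Relation.Binary.PropositionalEquality using (_≡_)
open import Relation.Nullary.Decidable using (⌊_⌋)
open import Function.Bundles using (_↔_; _⇔_; Inverse)
open import Function.Definitions using (Injective)

record Graph (n : ℕ) : Set where
  field
    adj    : Fin n → Fin n → Bool
    sym    : ∀ u v → adj u v ≡ adj v u
    irrefl : ∀ v → adj v v ≡ false
open Graph public

Isomorphic : ∀ {n m} → Graph n → Graph m → Set
Isomorphic {n} {m} G H =
  Σ (Fin n ↔ Fin m) λ f →
    ∀ u v → adj G u v ≡ adj H (Inverse.to f u) (Inverse.to f v)

VSet : ∀ {n} → Subset n → Set
VSet {n} S = Σ (Fin n) λ v → lookup S v ≡ true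

InducedIso : ∀ {n m} → Graph n → Subset n → Graph m → Subset m → Set
InducedIso G S H T =
  Σ (VSet S ↔ VSet T) λ f →
    ∀ x y → adj G (proj₁ x) (proj₁ y)
          ≡ adj H (proj₁ (Inverse.to f x)) (proj₁ (Inverse.to f y))

Card : ℕ → Set
Card n = Σ (Subset n) λ S → 2 * ∣ S ∣ ≤ n + 2

-- D(G) = D(H) as multisets of isomorphism classes: a bijection between the
-- cards of G and of H matching each card to an isomorphic one.
SameDeck : ∀ {n m} → Graph n → Graph m → Set
SameDeck {n} {m} G H =
  Σ (Card n ↔ Card m) λ φ →
    ∀ c → InducedIso G (proj₁ c) H (proj₁ (Inverse.to φ c))

Connected : ∀ {n} → Graph n → Set
Connected {n} G =
  ∀ u v → ∃ λ k → Σ (Fin (suc k) → Fin n) λ w →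
    (w fzero ≡ u) × (w (fromℕ k) ≡ v) ×
    (∀ (i : Fin k) → adj G (w (inject₁ i)) (w (fsuc i)) ≡ true)

Cycle : ∀ {n} → Graph n → Set
Cycle {n} G =
  ∃ λ k → Σ (Fin (3 + k) → Fin n) λ c →
    Injective _≡_ _≡_ c ×
    (∀ (i : Fin (2 + k)) → adj G (c (inject₁ i)) (c (fsuc i)) ≡ true) ×
    (adj G (c (fromℕ (2 + k))) (c fzero) ≡ true)

IsTree : ∀ {n} → Graph n → Set
IsTree G = Connected G × (Cycle G → Data.Empty.⊥)
  where import Data.Empty

degree : ∀ {n} → Graph n → Fin n → ℕ
degree G v = ∣ tabulate (adj G v) ∣

nonLeaves : ∀ {n} → Graph n → Subset n
nonLeaves G = tabulate λ v → not ⌊ degree G v ≟ 1 ⌋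

SpineIsPath : ∀ {n} → Graph n → Set
SpineIsPath G =
  Σ (Fin ∣ nonLeaves G ∣ ↔ VSet (nonLeaves G)) λ p →
    ∀ i j → (adj G (proj₁ (Inverse.to p i)) (proj₁ (Inverse.to p j)) ≡ true)
          ⇔ ((toℕ j ≡ suc (toℕ i)) ⊎ (toℕ i ≡ suc (toℕ j)))

IsCaterpillar : ∀ {n} → Graph n → Set
IsCaterpillar G = IsTree G × SpineIsPath G

{-# OPTIONS --safe #-}

-- Let r be the number of spine vertices; cards have room for r + 4 vertices.
-- Moving each tuple of vertices by the isomorphism of the card it spans turns
-- the deck into a bijection between the q-tuples of G and those of H, for every
-- q ≤ r + 4, that preserves adjacency and equality of entries.
--
-- In G an induced path on r + 2 vertices is the spine with a leaf at both ends,
-- and every vertex off the spine has one neighbour, on the spine.  The latter is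
-- a condition on pairs of vertices together with such a path, so it passes to H.
--
-- Let α k be the number of leaves at the k-th spine vertex of G, β that of H.
-- Counting paths with two marked leaves, and using that a path runs along the
-- spine in one of two directions, gives αᵢ + αᵢ′ = βᵢ + βᵢ′ and
-- αᵢ αⱼ + αᵢ′ αⱼ′ = βᵢ βⱼ + βᵢ′ βⱼ′, where ′ is the reflection of the spine.
-- These force β to be α or its reflection.
module Submission where

open import Defs renaming (sym to adj-sym; irrefl to adj-irrefl)
import Axiom.UniquenessOfIdentityProofs as UIP
open import Data.Bool using (Bool; true; false; not; _∧_)
import Data.Bool.Properties as Bool
open import Data.Empty using (⊥; ⊥-elim)
open import Data.Fin using (Fin; toℕ; inject₁; fromℕ; opposite; _≟_) renaming (zero to fzero; suc to fsuc)
open import Data.Fin.Induction using (<-weakInduction)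
open import Data.Fin.Permutation using (↔⇒≡)
import Data.Fin.Properties as Fin
open import Data.Fin.Subset using (Subset; ∣_∣)
open import Data.Integer as ℤ using (ℤ) renaming (+_ to pos)
import Data.Integer.Properties as ℤ
import Data.Integer.Tactic.RingSolver as ℤRing
open import Data.List using (List; []; _∷_; map; allFin; cartesianProductWith)
open import Data.List.Membership.Propositional using (_∈_)
open import Data.List.Membership.Propositional.Properties
  using (∈-allFin; ∈-cartesianProductWith⁺; ∈-map⁺)
open import Data.List.Membership.Propositional.Properties.WithK using (unique∧set⇒bag)
import Data.List.Properties as List
open import Data.List.Relation.Binary.BagAndSetEquality using (∼bag⇒↭)
open import Data.List.Relation.Binary.Permutation.Propositional using (_↭_)
import Data.List.Relation.Binary.Permutation.Propositional.Properties as ↭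
open import Data.List.Relation.Unary.All using ([])
open import Data.List.Relation.Unary.AllPairs using ([]; _∷_)
open import Data.List.Relation.Unary.Any using (here; there)
open import Data.List.Relation.Unary.Unique.Propositional using (Unique)
import Data.List.Relation.Unary.Unique.Propositional.Properties as Unique
open import Data.Maybe as Maybe using (Maybe; just; nothing)
open import Data.Nat using (ℕ; zero; suc; _+_; _*_; _≤_; _<_; z≤n; s≤s; NonZero; >-nonZero; >-nonZero⁻¹)
open import Data.Nat.ListAction using (sum)
open import Data.Nat.ListAction.Properties using (sum-++; sum-↭)
import Data.Nat.Properties as ℕ
open import Data.Nat.Tactic.RingSolver using (solve-∀)
open import Data.Product using (Σ; ∃; _×_; _,_; proj₁; proj₂)
open import Data.Sum as Sum using (_⊎_; inj₁; inj₂)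
open import Data.Unit using (⊤; tt)
open import Data.Vec using (Vec; []; _∷_; lookup; tabulate; head)
import Data.Vec.Properties as Vec
open import Data.Vec.Properties using (lookup∘tabulate; tabulate∘lookup; tabulate-cong)
open import Function using (_∘_; id; case_of_)
open import Function.Bundles using (_↔_; Inverse; Equivalence; mk↔ₛ′; mk⇔)
open import Function.Properties.Inverse using (↔-sym; ↔-trans)
open import Level using (0ℓ)
open import Relation.Binary.PropositionalEquality
  using (_≡_; _≢_; refl; sym; trans; cong; cong₂; subst; module ≡-Reasoning)
open import Relation.Nullary using (Dec; yes; no; does; contradiction)
open import Relation.Nullary.Decidable
  using (⌊_⌋; dec-true; does-⇔; ¬?; _×-dec_; _→-dec_; _⊎-dec_)
open import Relation.Unary using (Pred; Decidable)
open Inverse using (to; from; strictlyInverseˡ; strictlyInverseʳ)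

private
  variable
    n m p q r : ℕ
    A B : Set

-- Cards and labelled tuples

↔-injective : ∀ {A B : Set} (e : A ↔ B) {x y} → to e x ≡ to e y → x ≡ y
↔-injective e {x} {y} eq =
  trans (sym (strictlyInverseʳ e x)) (trans (cong (from e) eq) (strictlyInverseʳ e y))

does⁻ : ∀ {A : Set} (a? : Dec A) → does a? ≡ true → A
does⁻ (yes a) _ = a

comprehension : {P : Pred (Fin n) 0ℓ} → Decidable P → Subset n
comprehension P? = tabulate (does ∘ P?)

module _ {P : Pred (Fin n) 0ℓ} (P? : Decidable P) where

  ∈-comprehension⁺ : ∀ {v} → P v → lookup (comprehension P?) v ≡ true
  ∈-comprehension⁺ {v} p = trans (lookup∘tabulate _ v) (dec-true (P? v) p)

  ∈-comprehension⁻ : ∀ {v} → lookup (comprehension P?) v ≡ true → P v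
  ∈-comprehension⁻ {v} e = does⁻ (P? v) (trans (sym (lookup∘tabulate _ v)) e)

bool-ext : ∀ {a b} → (a ≡ true → b ≡ true) → (b ≡ true → a ≡ true) → a ≡ b
bool-ext {true}          f g = sym (f refl)
bool-ext {false} {true}  f g = g refl
bool-ext {false} {false} f g = refl

vec-ext : ∀ {A : Set} {x y : Vec A n} → (∀ i → lookup x i ≡ lookup y i) → x ≡ y
vec-ext {x = x} {y} e =
  trans (sym (tabulate∘lookup x)) (trans (tabulate-cong e) (tabulate∘lookup y))

subset-ext : {S T : Subset n} → (∀ v → lookup S v ≡ true → lookup T v ≡ true) →
             (∀ v → lookup T v ≡ true → lookup S v ≡ true) → S ≡ T
subset-ext f g = vec-ext λ v → bool-ext (f v) (g v)

VSet-≡ : (S : Subset n) {x y : VSet S} → proj₁ x ≡ proj₁ y → x ≡ y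
VSet-≡ _ {v , p} {.v , p′} refl = cong (v ,_) (UIP.Decidable⇒UIP.≡-irrelevant Bool._≟_ p p′)

VSet↔Fin : (S : Subset n) → VSet S ↔ Fin ∣ S ∣
VSet↔Fin []          = mk↔ₛ′ (λ { (() , _) }) (λ ()) (λ ()) λ { (() , _) }
VSet↔Fin (true ∷ S)  = mk↔ₛ′ f g fg gf
  where
  e = VSet↔Fin S
  f : VSet (true ∷ S) → Fin (suc ∣ S ∣)
  f (fzero  , p) = fzero
  f (fsuc v , p) = fsuc (to e (v , p))
  g : Fin (suc ∣ S ∣) → VSet (true ∷ S)
  g fzero    = fzero , refl
  g (fsuc i) = fsuc (proj₁ (from e i)) , proj₂ (from e i)
  fg : ∀ i → f (g i) ≡ i
  fg fzero    = refl
  fg (fsuc i) = cong fsuc (strictlyInverseˡ e i)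
  gf : ∀ x → g (f x) ≡ x
  gf (fzero  , p) = VSet-≡ (true ∷ S) refl
  gf (fsuc v , p) = VSet-≡ (true ∷ S) (cong (fsuc ∘ proj₁) (strictlyInverseʳ e (v , p)))
VSet↔Fin (false ∷ S) = mk↔ₛ′ f g fg gf
  where
  e = VSet↔Fin S
  f : VSet (false ∷ S) → Fin ∣ S ∣
  f (fsuc v , p) = to e (v , p)
  g : Fin ∣ S ∣ → VSet (false ∷ S)
  g i = fsuc (proj₁ (from e i)) , proj₂ (from e i)
  fg : ∀ i → f (g i) ≡ i
  fg i = strictlyInverseˡ e i
  gf : ∀ x → g (f x) ≡ x
  gf (fsuc v , p) = VSet-≡ (false ∷ S) (cong (fsuc ∘ proj₁) (strictlyInverseʳ e (v , p)))

inImage? : (f : Fin q → Fin n) → Decidable λ v → ∃ λ i → f i ≡ v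
inImage? f v = Fin.any? λ i → f i ≟ v

image : (Fin q → Fin n) → Subset n
image f = comprehension (inImage? f)

module _ (f : Fin q → Fin n) where

  ∈-image⁺ : ∀ i → lookup (image f) (f i) ≡ true
  ∈-image⁺ i = ∈-comprehension⁺ (inImage? f) (i , refl)

  ∈-image⁻ : ∀ {v} → lookup (image f) v ≡ true → ∃ λ i → f i ≡ v
  ∈-image⁻ = ∈-comprehension⁻ (inImage? f)

  -- Entries of a tuple may repeat, so only a bound is available: each vertex of the image chooses
  -- an index where `f` hits it, and `f` recovers the vertex from that index.
  ∣image∣≤ : ∣ image f ∣ ≤ q
  ∣image∣≤ = Fin.injective⇒≤ {f = λ a → index (from e a)} λ {a} {b} eq →
    ↔-injective (↔-sym e) (index-injective eq)
    where
    e = VSet↔Fin (image f)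
    index : VSet (image f) → Fin q
    index x = proj₁ (∈-image⁻ (proj₂ x))
    index-injective : ∀ {x y} → index x ≡ index y → x ≡ y
    index-injective {x} {y} e = VSet-≡ (image f)
      (trans (sym (proj₂ (∈-image⁻ (proj₂ x)))) (trans (cong f e) (proj₂ (∈-image⁻ (proj₂ y)))))

-- Equality is recorded next to adjacency because tuples may repeat vertices.
record SamePattern (G : Graph n) (H : Graph m) (f : Fin q → Fin n) (g : Fin q → Fin m) : Set where
  constructor samePattern
  field
    adj-≡ : ∀ i j → adj G (f i) (f j) ≡ adj H (g i) (g j)
    eq⁺   : ∀ i j → f i ≡ f j → g i ≡ g j
    eq⁻   : ∀ i j → g i ≡ g j → f i ≡ f j

SamePattern-sym : {G : Graph n} {H : Graph m} {f : Fin q → Fin n} {g : Fin q → Fin m} →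
                  SamePattern G H f g → SamePattern H G g f
SamePattern-sym (samePattern a e⁺ e⁻) = samePattern (λ i j → sym (a i j)) e⁻ e⁺

Card-≡ : {c d : Card n} → proj₁ c ≡ proj₁ d → c ≡ d
Card-≡ {c = S , p} {.S , p′} refl = cong (S ,_) (ℕ.≤-irrelevant p p′)

-- A tuple x is moved by the isomorphism that belongs to the card spanned by x;
-- this makes the unlabelled cards act on labelled tuples.
module _ {G : Graph n} {H : Graph m} (deck : SameDeck G H) where

  private
    φ = proj₁ deck
    iso : ∀ c → VSet (proj₁ c) ↔ VSet (proj₁ (to φ c))
    iso c = proj₁ (proj₂ deck c)

  -- The card `c` comes with an equation to `image x` instead of being built from `x`, so that a
  -- card found as the preimage of a card of `H` can also serve.
  Corresponding : (Fin q → Fin n) → (Fin q → Fin m) → Set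
  Corresponding x y = Σ (Card n) λ c → proj₁ c ≡ image x ×
    (∀ i p → proj₁ (to (iso c) (x i , p)) ≡ y i)

  private
    mem : ∀ {x : Fin q → Fin n} {S} → S ≡ image x → ∀ i → lookup S (x i) ≡ true
    mem {x = x} refl i = ∈-image⁺ x i

  corresponding-pattern : ∀ {x : Fin q → Fin n} {y} → Corresponding x y → SamePattern G H x y
  corresponding-pattern {x = x} {y} (c , e , t) = samePattern
    (λ i j → trans (proj₂ (proj₂ deck c) (x i , mem e i) (x j , mem e j))
                   (cong₂ (adj H) (t i _) (t j _)))
    (λ i j x≡ → trans (sym (t i (mem e i)))
                  (trans (cong (proj₁ ∘ to (iso c)) (VSet-≡ (proj₁ c) x≡)) (t j (mem e j))))
    (λ i j y≡ → cong proj₁ (↔-injective (iso c) {x i , mem e i} {x j , mem e j}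
                  (VSet-≡ (proj₁ (to φ c)) (trans (t i _) (trans y≡ (sym (t j _)))))))

  -- The isomorphism is onto the vertices of its card, so `y` lists all of them. Thus `y` determines
  -- the card of `H`, which injectivity needs.
  corresponding-image : ∀ {x : Fin q → Fin n} {y} ((c , _) : Corresponding x y) →
                        proj₁ (to φ c) ≡ image y
  corresponding-image {x = x} {y} (c , e , t) = subset-ext ⊆ ⊇
    where
    ⊆ : ∀ v → lookup (proj₁ (to φ c)) v ≡ true → lookup (image y) v ≡ true
    ⊆ v p with from (iso c) (v , p) in eq
    ... | u , s with ∈-image⁻ x (subst (λ S → lookup S u ≡ true) e s)
    ... | i , refl = subst (λ w → lookup (image y) w ≡ true) yi≡v (∈-image⁺ y i)
      where
      yi≡v : y i ≡ v
      yi≡v = trans (sym (t i s)) (cong proj₁ (trans (cong (to (iso c)) (sym eq)) (strictlyInverseˡ (iso c) (v , p))))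
    ⊇ : ∀ v → lookup (image y) v ≡ true → lookup (proj₁ (to φ c)) v ≡ true
    ⊇ v p with ∈-image⁻ y p
    ... | i , refl = subst (λ w → lookup (proj₁ (to φ c)) w ≡ true) (t i (mem e i))
                       (proj₂ (to (iso c) (x i , mem e i)))

  corresponding-functional : ∀ {x : Fin q → Fin n} {y y′} →
    Corresponding x y → Corresponding x y′ → ∀ i → y i ≡ y′ i
  corresponding-functional (c , e , t) (c′ , e′ , t′) i with Card-≡ {c = c} {c′} (trans e (sym e′))
  ... | refl = trans (sym (t i (mem e i))) (t′ i (mem e i))

  -- The image of `y` fixes the card of `H`; as `φ` is injective, it fixes the card of `G` and with
  -- it the isomorphism, which is then inverted.
  corresponding-injective : ∀ {x x′ : Fin q → Fin n} {y} →
    Corresponding x y → Corresponding x′ y → ∀ i → x i ≡ x′ i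
  corresponding-injective {x = x} {x′} {y} r@(c , e , t) r′@(c′ , e′ , t′) i
    with ↔-injective φ {c} {c′} (Card-≡ (trans (corresponding-image r) (sym (corresponding-image r′))))
  ... | refl = cong proj₁ (↔-injective (iso c) {x i , mem e i} {x′ i , mem e′ i}
                 (VSet-≡ (proj₁ (to φ c)) (trans (t i _) (sym (t′ i _)))))

  corresponding-total : 2 * q ≤ n + 2 → (x : Fin q → Fin n) →
    Σ (Vec (Fin m) q) λ y → Corresponding x (lookup y)
  corresponding-total q≤ x = tabulate y , c , refl ,
    λ i p → trans (cong (proj₁ ∘ to (iso c)) (VSet-≡ (image x) refl)) (sym (lookup∘tabulate y i))
    where
    c : Card n
    c = image x , ℕ.≤-trans (ℕ.*-monoʳ-≤ 2 (∣image∣≤ x)) q≤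
    y : Fin _ → Fin m
    y i = proj₁ (to (iso c) (x i , ∈-image⁺ x i))

  -- The tuple lists the vertices of `to φ c` for an arbitrary `c`, so that the equation between
  -- `to φ (from φ d)` and `d` is later used on memberships only and never rewrites the isomorphism.
  corresponding-pullback : (c : Card n) (y : Fin q → Fin m) (y∈ : ∀ i → lookup (proj₁ (to φ c)) (y i) ≡ true) →
    (∀ {w} → lookup (proj₁ (to φ c)) w ≡ true → ∃ λ i → y i ≡ w) →
    (x : Fin q → Fin n) → (∀ i → x i ≡ proj₁ (from (iso c) (y i , y∈ i))) → Corresponding x y
  corresponding-pullback c y y∈ y-onto x x≡ = c , subset-ext ⊆ ⊇ ,
    λ i p → trans (cong (proj₁ ∘ to (iso c)) (VSet-≡ (proj₁ c) (x≡ i)))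
                  (cong proj₁ (strictlyInverseˡ (iso c) (y i , y∈ i)))
    where
    ⊆ : ∀ v → lookup (proj₁ c) v ≡ true → lookup (image x) v ≡ true
    ⊆ v p with to (iso c) (v , p) in eq
    ... | w , s with y-onto s
    ... | i , refl = subst (λ u → lookup (image x) u ≡ true) xi≡v (∈-image⁺ x i)
      where
      xi≡v : x i ≡ v
      xi≡v = trans (x≡ i) (cong proj₁ (trans
        (cong (from (iso c)) (trans (VSet-≡ (proj₁ (to φ c)) refl) (sym eq)))
        (strictlyInverseʳ (iso c) (v , p))))
    ⊇ : ∀ v → lookup (image x) v ≡ true → lookup (proj₁ c) v ≡ true
    ⊇ v p with ∈-image⁻ x p
    ... | i , refl = subst (λ u → lookup (proj₁ c) u ≡ true) (sym (x≡ i))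
                       (proj₂ (from (iso c) (y i , y∈ i)))

  corresponding-surjective : 2 * q ≤ m + 2 → (y : Fin q → Fin m) →
    Σ (Vec (Fin n) q) λ x → Corresponding (lookup x) y
  corresponding-surjective {q = q} q≤ y = tabulate x ,
    corresponding-pullback (from φ d) y y∈
      (λ {w} s → ∈-image⁻ y (subst (λ d → lookup (proj₁ d) w ≡ true) φc≡d s))
      (lookup (tabulate x)) (lookup∘tabulate x)
    where
    d : Card m
    d = image y , ℕ.≤-trans (ℕ.*-monoʳ-≤ 2 (∣image∣≤ y)) q≤
    φc≡d : to φ (from φ d) ≡ d
    φc≡d = strictlyInverseˡ φ d
    y∈ : ∀ i → lookup (proj₁ (to φ (from φ d))) (y i) ≡ true
    y∈ i = subst (λ d → lookup (proj₁ d) (y i) ≡ true) (sym φc≡d) (∈-image⁺ y i)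
    x : Fin q → Fin n
    x i = proj₁ (from (iso (from φ d)) (y i , y∈ i))

  -- Both orders are bounded, since `n` and `m` are compared only afterwards, by means of this
  -- bijection.
  tuples↔ : 2 * q ≤ n + 2 → 2 * q ≤ m + 2 → Σ (Vec (Fin n) q ↔ Vec (Fin m) q) λ ψ →
            ∀ x → SamePattern G H (lookup x) (lookup (to ψ x))
  tuples↔ {q = q} q≤ q≤′ = mk↔ₛ′ f g fg gf , λ x → corresponding-pattern (proj₂ (push x))
    where
    push = λ (x : Vec (Fin n) q) → corresponding-total q≤ (lookup x)
    pull = λ (y : Vec (Fin m) q) → corresponding-surjective q≤′ (lookup y)
    f = λ x → proj₁ (push x)
    g = λ y → proj₁ (pull y)
    fg : ∀ y → f (g y) ≡ y
    fg y = vec-ext (corresponding-functional (proj₂ (push (g y))) (proj₂ (pull y)))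
    gf : ∀ x → g (f x) ≡ x
    gf x = vec-ext (corresponding-injective (proj₂ (pull (f x))) (proj₂ (push x)))

Vec1↔ : ∀ {A : Set} → Vec A 1 ↔ A
Vec1↔ {A} = mk↔ₛ′ head (_∷ []) (λ _ → refl) λ { (a ∷ []) → refl }

-- A 1-tuple is a vertex, and a single vertex fits on a card whatever the order: `2 * 1 ≤ n + 2`.
sameDeck⇒sameOrder : {G : Graph n} {H : Graph m} → SameDeck G H → n ≡ m
sameDeck⇒sameOrder {n} {m} {G} {H} deck =
  ↔⇒≡ (↔-trans (↔-sym Vec1↔) (↔-trans (proj₁ (tuples↔ {G = G} {H} deck (ℕ.m≤n+m 2 n) (ℕ.m≤n+m 2 m))) Vec1↔))

-- Sums over tuples

⟦_⟧ : Bool → ℕ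
⟦ true ⟧  = 1
⟦ false ⟧ = 0

⟦∧⟧ : ∀ a b → ⟦ a ∧ b ⟧ ≡ ⟦ a ⟧ * ⟦ b ⟧
⟦∧⟧ true  b = sym (ℕ.+-identityʳ ⟦ b ⟧)
⟦∧⟧ false b = refl

∑ : List A → (A → ℕ) → ℕ
∑ xs f = sum (map f xs)

∑-cong : ∀ (xs : List A) {f g} → (∀ x → f x ≡ g x) → ∑ xs f ≡ ∑ xs g
∑-cong xs e = cong sum (List.map-cong e xs)

∑-+ : ∀ (xs : List A) (f g : A → ℕ) → ∑ xs (λ x → f x + g x) ≡ ∑ xs f + ∑ xs g
∑-+ []       f g = refl
∑-+ (x ∷ xs) f g = trans (cong (f x + g x +_) (∑-+ xs f g)) (lemma (f x) (g x) (∑ xs f) (∑ xs g))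
  where
  lemma : ∀ a b c d → a + b + (c + d) ≡ a + c + (b + d)
  lemma = solve-∀

∑-*ˡ : ∀ (xs : List A) c (f : A → ℕ) → ∑ xs (λ x → c * f x) ≡ c * ∑ xs f
∑-*ˡ []       c f = sym (ℕ.*-zeroʳ c)
∑-*ˡ (x ∷ xs) c f = trans (cong (c * f x +_) (∑-*ˡ xs c f)) (sym (ℕ.*-distribˡ-+ c (f x) (∑ xs f)))

∑-*ʳ : ∀ (xs : List A) c (f : A → ℕ) → ∑ xs (λ x → f x * c) ≡ ∑ xs f * c
∑-*ʳ xs c f = trans (∑-cong xs λ x → ℕ.*-comm (f x) c) (trans (∑-*ˡ xs c f) (ℕ.*-comm c (∑ xs f)))

∑-0 : ∀ (xs : List A) → ∑ xs (λ _ → 0) ≡ 0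
∑-0 []       = refl
∑-0 (x ∷ xs) = ∑-0 xs

∑-comm : ∀ (xs : List A) (ys : List B) (f : A → B → ℕ) → ∑ xs (λ x → ∑ ys (f x)) ≡ ∑ ys (λ y → ∑ xs (λ x → f x y))
∑-comm []       ys f = sym (∑-0 ys)
∑-comm (x ∷ xs) ys f = trans (cong (∑ ys (f x) +_) (∑-comm xs ys f))
                             (sym (∑-+ ys (f x) λ y → ∑ xs λ x → f x y))

term≤∑ : ∀ {xs : List A} {x} f → x ∈ xs → f x ≤ ∑ xs f
term≤∑ f (here refl) = ℕ.m≤m+n _ _
term≤∑ f (there x∈)  = ℕ.≤-trans (term≤∑ f x∈) (ℕ.m≤n+m _ _)

∑-allFin-suc : ∀ (f : Fin (suc n) → ℕ) → ∑ (allFin (suc n)) f ≡ f fzero + ∑ (allFin n) (f ∘ fsuc)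
∑-allFin-suc f = cong (λ xs → f fzero + sum xs)
  (trans (List.map-tabulate fsuc f) (sym (List.map-tabulate (λ i → i) (f ∘ fsuc))))

∑-allFin-⟦⟧ : ∀ (b : Fin n → Bool) → ∑ (allFin n) (⟦_⟧ ∘ b) ≡ ∣ tabulate b ∣
∑-allFin-⟦⟧ {zero}  b = refl
∑-allFin-⟦⟧ {suc n} b = trans (∑-allFin-suc (⟦_⟧ ∘ b))
  (trans (cong (⟦ b fzero ⟧ +_) (∑-allFin-⟦⟧ (b ∘ fsuc))) (count-∷ (b fzero) (tabulate (b ∘ fsuc))))
  where
  count-∷ : ∀ {k} a (S : Subset k) → ⟦ a ⟧ + ∣ S ∣ ≡ ∣ a ∷ S ∣
  count-∷ true  S = refl
  count-∷ false S = refl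

vecs : ∀ n q → List (Vec (Fin n) q)
vecs n zero    = [] ∷ []
vecs n (suc q) = cartesianProductWith _∷_ (allFin n) (vecs n q)

∈-vecs : ∀ (x : Vec (Fin n) q) → x ∈ vecs n q
∈-vecs []      = here refl
∈-vecs (v ∷ x) = ∈-cartesianProductWith⁺ _∷_ (∈-allFin v) (∈-vecs x)

vecs-unique : ∀ n q → Unique (vecs n q)
vecs-unique n zero    = [] ∷ []
vecs-unique n (suc q) =
  Unique.cartesianProductWith⁺ _∷_ Vec.∷-injective (Unique.allFin⁺ n) (vecs-unique n q)

-- Each list of tuples is complete and free of repetitions, so mapping the bijection `ψ` over one
-- list gives a permutation of the other.
∑-vecs-↔ : (ψ : Vec (Fin n) q ↔ Vec (Fin m) q) → ∀ {f g} → (∀ x → f x ≡ g (to ψ x)) →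
           ∑ (vecs n q) f ≡ ∑ (vecs m q) g
∑-vecs-↔ {n} {q} {m} ψ {f} {g} e = trans (∑-cong (vecs n q) e)
  (trans (cong sum (List.map-∘ (vecs n q))) (sum-↭ (↭.map⁺ g images↭)))
  where
  images↭ : map (to ψ) (vecs n q) ↭ vecs m q
  images↭ = ∼bag⇒↭ (unique∧set⇒bag (Unique.map⁺ (↔-injective ψ) (vecs-unique n q)) (vecs-unique m q)
    λ {y} → mk⇔ (λ _ → ∈-vecs y) λ _ → subst (_∈ map (to ψ) (vecs n q)) (strictlyInverseˡ ψ y)
      (∈-map⁺ (to ψ) (∈-vecs (from ψ y))))

∑-vecs-suc : ∀ n q f → ∑ (vecs n (suc q)) f ≡ ∑ (allFin n) (λ v → ∑ (vecs n q) (λ x → f (v ∷ x)))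
∑-vecs-suc n q f = go (allFin n)
  where
  go : ∀ vs → ∑ (cartesianProductWith _∷_ vs (vecs n q)) f ≡ ∑ vs (λ v → ∑ (vecs n q) (λ x → f (v ∷ x)))
  go []       = refl
  go (v ∷ vs) = trans (cong sum (List.map-++ f (map (v ∷_) (vecs n q)) _))
    (trans (sum-++ (map f (map (v ∷_) (vecs n q))) _)
      (cong₂ _+_ (cong sum (sym (List.map-∘ (vecs n q)))) (go vs)))

∑-product : ∀ (xs : List A) (f g : A → ℕ) → ∑ xs (λ z → ∑ xs (λ w → f z * g w)) ≡ ∑ xs f * ∑ xs g
∑-product xs f g = trans (∑-cong xs λ z → ∑-*ˡ xs (f z) g) (∑-*ʳ xs (∑ xs g) f)

-- For a fixed tail `x` the two leading entries vary independently, so their double sum is a product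
-- of two sums. This turns counts of marked paths into products of leg counts.
∑-vecs-2+ : ∀ n q {f : Vec (Fin n) (2 + q) → ℕ}
  (p : Vec (Fin n) q → ℕ) (a b : Vec (Fin n) q → Fin n → ℕ) →
  (∀ z w x → f (z ∷ w ∷ x) ≡ p x * (a x z * b x w)) →
  ∑ (vecs n (2 + q)) f ≡ ∑ (vecs n q) (λ x → p x * (∑ (allFin n) (a x) * ∑ (allFin n) (b x)))
∑-vecs-2+ n q {f} p a b e = begin
  ∑ (vecs n (2 + q)) f
    ≡⟨ ∑-vecs-suc n (suc q) f ⟩
  ∑ V (λ z → ∑ (vecs n (suc q)) (λ y → f (z ∷ y)))
    ≡⟨ ∑-cong V (λ z → trans (∑-vecs-suc n q (λ y → f (z ∷ y))) (∑-comm V (vecs n q) λ w x → f (z ∷ w ∷ x))) ⟩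
  ∑ V (λ z → ∑ (vecs n q) (λ x → ∑ V (λ w → f (z ∷ w ∷ x))))
    ≡⟨ ∑-comm V (vecs n q) (λ z x → ∑ V (λ w → f (z ∷ w ∷ x))) ⟩
  ∑ (vecs n q) (λ x → ∑ V (λ z → ∑ V (λ w → f (z ∷ w ∷ x))))
    ≡⟨ ∑-cong (vecs n q) (λ x → begin
         ∑ V (λ z → ∑ V (λ w → f (z ∷ w ∷ x)))
           ≡⟨ ∑-cong V (λ z → trans (∑-cong V (λ w → e z w x)) (∑-*ˡ V (p x) (λ w → a x z * b x w))) ⟩
         ∑ V (λ z → p x * ∑ V (λ w → a x z * b x w))
           ≡⟨ ∑-*ˡ V (p x) (λ z → ∑ V (λ w → a x z * b x w)) ⟩
         p x * ∑ V (λ z → ∑ V (λ w → a x z * b x w))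
           ≡⟨ cong (p x *_) (∑-product V (a x) (b x)) ⟩
         p x * (∑ V (a x) * ∑ V (b x)) ∎) ⟩
  ∑ (vecs n q) (λ x → p x * (∑ V (a x) * ∑ V (b x))) ∎
  where
  open ≡-Reasoning
  V = allFin n

-- Induced paths and spines

Near : Fin r → Fin r → Set
Near i j = (toℕ j ≡ suc (toℕ i)) ⊎ (toℕ i ≡ suc (toℕ j))

near? : (i j : Fin r) → Dec (Near i j)
near? i j = (toℕ j ℕ.≟ suc (toℕ i)) ⊎-dec (toℕ i ℕ.≟ suc (toℕ j))

Near-sym : {i j : Fin r} → Near i j → Near j i
Near-sym = Sum.swap

near-inject₁ : (i : Fin r) → Near (inject₁ i) (fsuc i)
near-inject₁ i = inj₁ (cong suc (sym (Fin.toℕ-inject₁ i)))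

toℕ-opposite : (i : Fin r) → toℕ (opposite i) + suc (toℕ i) ≡ r
toℕ-opposite i = trans (cong (_+ suc (toℕ i)) (Fin.opposite-prop i)) (ℕ.m∸n+n≡m (Fin.toℕ<n i))

private
  near-opposite-suc : (i j : Fin r) → toℕ j ≡ suc (toℕ i) → toℕ (opposite i) ≡ suc (toℕ (opposite j))
  near-opposite-suc i j j≡ = ℕ.+-cancelʳ-≡ (suc (toℕ i)) _ _ (trans (toℕ-opposite i)
    (trans (sym (toℕ-opposite j)) (trans (cong (λ k → toℕ (opposite j) + suc k) j≡)
      (ℕ.+-suc (toℕ (opposite j)) (suc (toℕ i))))))

near-opposite : (i j : Fin r) → Near i j → Near (opposite i) (opposite j)
near-opposite i j (inj₁ e) = inj₂ (near-opposite-suc i j e)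
near-opposite i j (inj₂ e) = inj₁ (near-opposite-suc j i e)

-- A turn would return after two steps to the value just left, against injectivity, so all steps
-- have one sign. The falling case is written additively to avoid truncated subtraction.
monotone-walk : (f : Fin (suc m) → ℕ) → (∀ i j → f i ≡ f j → i ≡ j) →
  (∀ i → f (fsuc i) ≡ suc (f (inject₁ i)) ⊎ f (inject₁ i) ≡ suc (f (fsuc i))) →
  (∀ k → f k ≡ f fzero + toℕ k) ⊎ (∀ k → f k + toℕ k ≡ f fzero)
monotone-walk {zero} f inj step = inj₁ λ { fzero → sym (ℕ.+-identityʳ (f fzero)) }
monotone-walk {suc zero} f inj step with step fzero
... | inj₁ e = inj₁ λ { fzero → sym (ℕ.+-identityʳ (f fzero)) ; (fsuc fzero) → trans e (ℕ.+-comm 1 (f fzero)) }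
... | inj₂ e = inj₂ λ { fzero → ℕ.+-identityʳ (f fzero) ; (fsuc fzero) → trans (ℕ.+-comm (f (fsuc fzero)) 1) (sym e) }
monotone-walk {suc (suc m)} f inj step
  with step fzero | monotone-walk (f ∘ fsuc) (λ i j e → Fin.suc-injective (inj _ _ e)) (step ∘ fsuc)
... | inj₁ e | inj₁ up = inj₁ λ
  { fzero    → sym (ℕ.+-identityʳ (f fzero))
  ; (fsuc k) → trans (up k) (trans (cong (_+ toℕ k) e) (sym (ℕ.+-suc (f fzero) (toℕ k)))) }
... | inj₂ e | inj₂ down = inj₂ λ
  { fzero    → ℕ.+-identityʳ (f fzero)
  ; (fsuc k) → trans (ℕ.+-suc (f (fsuc k)) (toℕ k)) (trans (cong suc (down k)) (sym e)) }
... | inj₁ e | inj₂ down with inj fzero (fsuc (fsuc fzero))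
      (ℕ.suc-injective (trans (sym e) (trans (sym (down (fsuc fzero))) (ℕ.+-comm (f (fsuc (fsuc fzero))) 1))))
...   | ()
monotone-walk {suc (suc m)} f inj step | inj₂ e | inj₁ up with inj fzero (fsuc (fsuc fzero))
      (trans e (trans (ℕ.+-comm 1 (f (fsuc fzero))) (sym (up (fsuc fzero)))))
...   | ()

-- Consecutive positions go to neighbouring positions, so `g` is a monotone walk; its `r` values fit
-- into `Fin r` only if it starts at one end.
path-endomorphism : (g : Fin r → Fin r) → (∀ i j → g i ≡ g j → i ≡ j) →
  (∀ i j → Near i j → Near (g i) (g j)) → (∀ k → g k ≡ k) ⊎ (∀ k → g k ≡ opposite k)
path-endomorphism {zero}  g inj near = inj₁ λ ()
path-endomorphism {suc m} g inj near
  with monotone-walk (toℕ ∘ g) (λ i j e → inj i j (Fin.toℕ-injective e))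
         (λ i → near (inject₁ i) (fsuc i) (near-inject₁ i))
... | inj₁ up = inj₁ λ k → Fin.toℕ-injective (trans (up k) (cong (_+ toℕ k) g0≡0))
  where
  -- At the last index the value is `toℕ (g fzero) + m`, which must stay below `suc m`.
  g0≡0 : toℕ (g fzero) ≡ 0
  g0≡0 = ℕ.n≤0⇒n≡0 (ℕ.+-cancelʳ-≤ m _ _ (ℕ.≤-pred (subst (_< suc m)
    (trans (up (fromℕ m)) (cong (toℕ (g fzero) +_) (Fin.toℕ-fromℕ m))) (Fin.toℕ<n (g (fromℕ m))))))
... | inj₂ down = inj₂ λ k → Fin.toℕ-injective
    (ℕ.+-cancelʳ-≡ (suc (toℕ k)) _ _ (trans (ℕ.+-suc (toℕ (g k)) (toℕ k))
      (trans (cong suc (trans (down k) g0≡m)) (sym (toℕ-opposite k)))))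
  where
  g0≡m : toℕ (g fzero) ≡ m
  g0≡m = ℕ.≤-antisym (ℕ.≤-pred (Fin.toℕ<n (g fzero)))
    (subst (m ≤_) (trans (cong (toℕ (g (fromℕ m)) +_) (sym (Fin.toℕ-fromℕ m))) (down (fromℕ m)))
      (ℕ.m≤n+m m _))

-- A path is a labelled tuple, so its two directions count separately.
InducedPath : Graph n → (Fin q → Fin n) → Set
InducedPath K f =
  (∀ i j → f i ≡ f j → i ≡ j) ×
  (∀ i j → adj K (f i) (f j) ≡ true → Near i j) ×
  (∀ i j → Near i j → adj K (f i) (f j) ≡ true)

inducedPath? : (K : Graph n) (f : Fin q → Fin n) → Dec (InducedPath K f)
inducedPath? K f =
  (Fin.all? λ i → Fin.all? λ j → (f i ≟ f j) →-dec (i ≟ j)) ×-dec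
  (Fin.all? λ i → Fin.all? λ j → (adj K (f i) (f j) Bool.≟ true) →-dec near? i j) ×-dec
  (Fin.all? λ i → Fin.all? λ j → near? i j →-dec (adj K (f i) (f j) Bool.≟ true))

Pendant : Graph n → (Fin r → Fin n) → Fin n → Fin r → Set
Pendant K s v k = adj K v (s k) ≡ true × (∀ w → adj K v w ≡ true → w ≡ s k)

-- An end of `s` may be a leaf itself, so the two alternatives can overlap. Nothing global such as
-- connectedness is mentioned: the condition can be tested on `s` and two further vertices at a
-- time.
Spine : Graph n → (Fin r → Fin n) → Set
Spine K s = InducedPath K s × (∀ v → (∃ λ k → v ≡ s k) ⊎ ∃ (Pendant K s v))

inner : Fin r → Fin (2 + r)
inner k = fsuc (inject₁ k)

module _ {K : Graph n} where

  path-cong : {f g : Fin q → Fin n} → (∀ i → f i ≡ g i) → InducedPath K f → InducedPath K g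
  path-cong {f = f} {g} e (inj , adj⇒ , ⇒adj) =
    (λ i j p → inj i j (trans (e i) (trans p (sym (e j))))) ,
    (λ i j p → adj⇒ i j (trans (cong₂ (adj K) (e i) (e j)) p)) ,
    (λ i j p → trans (sym (cong₂ (adj K) (e i) (e j))) (⇒adj i j p))

  path-opposite : {f : Fin q → Fin n} → InducedPath K f → InducedPath K (f ∘ opposite)
  path-opposite (inj , adj⇒ , ⇒adj) =
    (λ i j p → back (inj _ _ p)) ,
    (λ i j p → subst₂Near (near-opposite _ _ (adj⇒ _ _ p))) ,
    (λ i j p → ⇒adj _ _ (near-opposite i j p))
    where
    back : ∀ {i j : Fin q} → opposite i ≡ opposite j → i ≡ j
    back {i = i} {j} p = trans (sym (Fin.opposite-involutive i))
      (trans (cong opposite p) (Fin.opposite-involutive j))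
    subst₂Near : ∀ {i j : Fin q} → Near (opposite (opposite i)) (opposite (opposite j)) → Near i j
    subst₂Near {i = i} {j} p rewrite Fin.opposite-involutive i | Fin.opposite-involutive j = p

  path-inner : {f : Fin (2 + r) → Fin n} → InducedPath K f → InducedPath K (f ∘ inner)
  path-inner (inj , adj⇒ , ⇒adj) =
    (λ i j p → Fin.inject₁-injective (Fin.suc-injective (inj _ _ p))) ,
    (λ i j p → Sum.map (strip i j) (strip j i) (adj⇒ _ _ p)) ,
    (λ i j p → ⇒adj _ _ (Sum.map (pad i j) (pad j i) p))
    where
    strip : ∀ (i j : Fin r) → toℕ (inner j) ≡ suc (toℕ (inner i)) → toℕ j ≡ suc (toℕ i)
    strip i j p rewrite Fin.toℕ-inject₁ i | Fin.toℕ-inject₁ j = ℕ.suc-injective p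
    pad : ∀ (i j : Fin r) → toℕ j ≡ suc (toℕ i) → toℕ (inner j) ≡ suc (toℕ (inner i))
    pad i j p rewrite Fin.toℕ-inject₁ i | Fin.toℕ-inject₁ j = cong suc p

  spine-cong : {s t : Fin r → Fin n} → (∀ k → s k ≡ t k) → Spine K s → Spine K t
  spine-cong {s = s} {t} e (path , cover) = path-cong e path ,
    λ v → Sum.map (λ (k , p) → k , trans p (e k))
      (λ (k , p , u) → k , trans (cong (adj K v) (sym (e k))) p , λ w a → trans (u w a) (e k)) (cover v)

  spine-opposite : {s : Fin r → Fin n} → Spine K s → Spine K (s ∘ opposite)
  spine-opposite {s = s} (path , cover) = path-opposite path ,
    λ v → Sum.map (λ (k , p) → opposite k , trans p (back k))
      (λ (k , p , u) → opposite k , trans (cong (adj K v) (sym (back k))) p , λ w a → trans (u w a) (back k))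
      (cover v)
    where
    back : ∀ k → s k ≡ s (opposite (opposite k))
    back k = cong s (sym (Fin.opposite-involutive k))

  -- An inner vertex of an induced path has two neighbours, so it lies on the spine.
  spine-rigid : {s : Fin r → Fin n} {y : Fin (2 + r) → Fin n} → Spine K s → InducedPath K y →
    (∀ k → y (inner k) ≡ s k) ⊎ (∀ k → y (inner k) ≡ s (opposite k))
  spine-rigid {r = r} {s} {y} ((_ , s-adj⇒ , _) , cover) path-y@(y-inj , _ , y⇒adj) =
    -- Each inner position of the path lands on a spine position; this self-map of the positions is
    -- injective and preserves nearness, hence is the identity or the reflection.
    Sum.map (λ e k → trans (yσ k) (cong s (e k))) (λ e k → trans (yσ k) (cong s (e k)))
      (path-endomorphism (proj₁ ∘ onSpine) σ-inj
        λ i j p → s-adj⇒ _ _ (trans (sym (cong₂ (adj K) (yσ i) (yσ j))) (proj₂ (proj₂ (path-inner path-y)) i j p)))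
    where
    onSpine : ∀ k → ∃ λ j → y (inner k) ≡ s j
    onSpine k with cover (y (inner k))
    ... | inj₁ p = p
    ... | inj₂ (j , _ , unique) = contradiction
      (cong toℕ (y-inj _ _ (trans
        (unique (y (inject₁ (inject₁ k)))
          (y⇒adj _ _ (Near-sym {i = inject₁ (inject₁ k)} (near-inject₁ (inject₁ k)))))
        (sym (unique (y (fsuc (fsuc k))) (y⇒adj _ _ (near-inject₁ (fsuc k))))))))
      -- The two neighbours of the inner vertex have positions `toℕ k` and `2 + toℕ k`.
      λ e → ℕ.m≢1+m+n (toℕ k) (trans (trans (sym (trans (Fin.toℕ-inject₁ (inject₁ k)) (Fin.toℕ-inject₁ k))) e)
              (cong suc (ℕ.+-comm 1 (toℕ k))))
    yσ : ∀ k → y (inner k) ≡ s (proj₁ (onSpine k))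
    yσ k = proj₂ (onSpine k)
    σ-inj : ∀ i j → proj₁ (onSpine i) ≡ proj₁ (onSpine j) → i ≡ j
    σ-inj i j e = proj₁ (path-inner path-y) i j (trans (yσ i) (trans (cong s e) (sym (yσ j))))

  path⇒spine : {s : Fin r → Fin n} {y : Fin (2 + r) → Fin n} → Spine K s → InducedPath K y →
    Spine K (y ∘ inner)
  path⇒spine spine path with spine-rigid spine path
  ... | inj₁ e = spine-cong (sym ∘ e) spine
  ... | inj₂ e = spine-cong (sym ∘ e) (spine-opposite spine)

-- Only what a tuple holding `s` and `v` can decide is asked; over a spine, `off-spine⇒pendant`
-- makes such a `v` pendant.
Leg : Graph n → (Fin r → Fin n) → Fin r → Fin n → Set
Leg K s k v = adj K (s k) v ≡ true × (∀ j → v ≢ s j)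

leg? : (K : Graph n) (s : Fin r → Fin n) (k : Fin r) (v : Fin n) → Dec (Leg K s k v)
leg? K s k v = (adj K (s k) v Bool.≟ true) ×-dec Fin.all? λ j → ¬? (v ≟ s j)

legs : Graph n → (Fin r → Fin n) → Fin r → ℕ
legs {n} K s k = ∑ (allFin n) λ v → ⟦ does (leg? K s k v) ⟧

-- A leg is described by the vertex it hangs from and by the set of spine vertices, so relabelling
-- the spine leaves the count unchanged.
legs-cong : {K : Graph n} {s t : Fin r → Fin n} {i j : Fin r} → s i ≡ t j →
  (∀ k → ∃ λ l → s k ≡ t l) → (∀ l → ∃ λ k → t l ≡ s k) → legs K s i ≡ legs K t j
legs-cong {n} {K = K} {s} {t} {i} {j} e s⊆t t⊆s = ∑-cong (allFin n) λ v → cong ⟦_⟧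
  (does-⇔ (mk⇔ (move e t⊆s) (move (sym e) s⊆t)) (leg? K s i v) (leg? K t j v))
  where
  move : ∀ {s t : Fin _ → Fin n} {i j v} → s i ≡ t j → (∀ l → ∃ λ k → t l ≡ s k) →
         Leg K s i v → Leg K t j v
  move e t⊆s (a , v∉s) = subst (λ u → adj K u _ ≡ true) e a ,
    λ l v≡ → v∉s (proj₁ (t⊆s l)) (trans v≡ (proj₂ (t⊆s l)))

legs-opposite : {K : Graph n} (s : Fin r → Fin n) (k : Fin r) → legs K (s ∘ opposite) k ≡ legs K s (opposite k)
legs-opposite {K = K} s k = legs-cong {K = K} {i = k} {opposite k} refl (λ k → opposite k , refl)
  λ l → opposite l , cong s (sym (Fin.opposite-involutive l))

legs-rigid : {K : Graph n} {s : Fin r → Fin n} {y : Fin (2 + r) → Fin n} → Spine K s → InducedPath K y →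
  (∀ k → legs K (y ∘ inner) k ≡ legs K s k) ⊎ (∀ k → legs K (y ∘ inner) k ≡ legs K s (opposite k))
legs-rigid {K = K} {s} spine path with spine-rigid {K = K} spine path
... | inj₁ e = inj₁ λ k → legs-cong {K = K} {i = k} (e k) (λ k → k , e k) λ l → l , sym (e l)
... | inj₂ e = inj₂ λ k → legs-cong {K = K} {i = k} (e k) (λ k → opposite k , e k)
                 λ l → opposite l , trans (cong s (sym (Fin.opposite-involutive l))) (sym (e (opposite l)))

-- Caterpillars

opposite-inject₁ : (k : Fin r) → opposite (inject₁ k) ≡ fsuc (opposite k)
opposite-inject₁ fzero    = refl
opposite-inject₁ (fsuc k) = cong inject₁ (opposite-inject₁ k)

cons : ∀ {A : Set} → A → (Fin q → A) → Fin (suc q) → A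
cons a f fzero    = a
cons a f (fsuc i) = f i

cons≢ : ∀ {A : Set} {a b : A} {f : Fin q → A} → b ≢ a → (∀ i → b ≢ f i) → ∀ i → b ≢ cons a f i
cons≢ b≢a b∉f fzero    = b≢a
cons≢ b≢a b∉f (fsuc i) = b∉f i

-- The neighbour of an end of a path; for a one-vertex path it is that vertex itself, a junk value.
second : Fin (suc r)
second {zero}  = fzero
second {suc r} = fsuc fzero

near-first : (j : Fin (suc r)) → Near fzero j → j ≡ second
near-first {zero}  fzero    p = refl
near-first {suc r} fzero    (inj₁ ())
near-first {suc r} fzero    (inj₂ ())
near-first {suc r} (fsuc j) (inj₁ p) = cong fsuc (Fin.toℕ-injective (ℕ.suc-injective p))

near-last : (j : Fin (suc r)) → Near (fromℕ r) j → j ≡ opposite second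
near-last {r} j p = trans (sym (Fin.opposite-involutive j)) (cong opposite
  (near-first (opposite j) (subst (λ i → Near i (opposite j)) (Fin.opposite-involutive fzero)
    (near-opposite (fromℕ r) j p))))

module _ {K : Graph n} where

  flip-adj : ∀ {u v} → adj K u v ≡ true → adj K v u ≡ true
  flip-adj {u} {v} = trans (adj-sym K v u)

  -- The point of attachment is given through `toℕ`, because `Fin q` has no `fzero` for general `q`.
  cons-path : ∀ {f : Fin q → Fin n} {a} → InducedPath K f → (∀ i → a ≢ f i) →
    (∀ i → adj K a (f i) ≡ true → toℕ i ≡ 0) → (∀ i → toℕ i ≡ 0 → adj K a (f i) ≡ true) →
    InducedPath K (cons a f)
  cons-path {f = f} {a} (inj , adj⇒ , ⇒adj) a∉f adj⇒0 0⇒adj = inj′ , adj⇒′ , ⇒adj′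
    where
    inj′ : ∀ i j → cons a f i ≡ cons a f j → i ≡ j
    inj′ fzero    fzero    e = refl
    inj′ fzero    (fsuc j) e = contradiction e (a∉f j)
    inj′ (fsuc i) fzero    e = contradiction (sym e) (a∉f i)
    inj′ (fsuc i) (fsuc j) e = cong fsuc (inj i j e)
    adj⇒′ : ∀ i j → adj K (cons a f i) (cons a f j) ≡ true → Near i j
    adj⇒′ fzero    fzero    p = contradiction (trans (sym p) (adj-irrefl K a)) λ ()
    adj⇒′ fzero    (fsuc j) p = inj₁ (cong suc (adj⇒0 j p))
    adj⇒′ (fsuc i) fzero    p = inj₂ (cong suc (adj⇒0 i (flip-adj p)))
    adj⇒′ (fsuc i) (fsuc j) p = Sum.map (cong suc) (cong suc) (adj⇒ i j p)
    ⇒adj′ : ∀ i j → Near i j → adj K (cons a f i) (cons a f j) ≡ true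
    ⇒adj′ fzero    fzero    (inj₁ ())
    ⇒adj′ fzero    fzero    (inj₂ ())
    ⇒adj′ fzero    (fsuc j) (inj₁ p) = 0⇒adj j (ℕ.suc-injective p)
    ⇒adj′ (fsuc i) fzero    (inj₂ p) = flip-adj (0⇒adj i (ℕ.suc-injective p))
    ⇒adj′ (fsuc i) (fsuc j) p = ⇒adj i j (Sum.map ℕ.suc-injective ℕ.suc-injective p)

  module _ {s : Fin r → Fin n} (spine : Spine K s) where

    -- The vertex from which `v` hangs is its only neighbour, so it must be `s k`.
    off-spine⇒pendant : ∀ {v k} → (∀ j → v ≢ s j) → adj K (s k) v ≡ true → Pendant K s v k
    off-spine⇒pendant {v} {k} v∉s a with proj₂ spine v
    ... | inj₁ (j , v≡) = contradiction v≡ (v∉s j)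
    ... | inj₂ (j , p , unique) = flip-adj a ,
      λ w aw → trans (unique w aw) (sym (unique (s k) (flip-adj a)))

    -- At an end of the spine all spine neighbours equal `u`, so a neighbour other than `u` lies off
    -- the spine. A one-vertex spine has no spine neighbours, and `u` is then free to exclude a leaf
    -- already chosen.
    off-spine-neighbour : (∀ k u → ∃ λ w → w ≢ u × adj K (s k) w ≡ true) →
      ∀ k u → (∀ j → Near k j → s j ≡ u) →
      ∃ λ w → w ≢ u × (∀ j → w ≢ s j) × Pendant K s w k
    off-spine-neighbour branch k u near⇒u with branch k u
    ... | w , w≢u , a = w , w≢u , w∉s , off-spine⇒pendant w∉s a
      where
      w∉s : ∀ j → w ≢ s j
      w∉s j refl = w≢u (near⇒u j (proj₁ (proj₂ (proj₁ spine)) k j a))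

  -- On a spine of one vertex both leaves hang from the same vertex, so `a` is excluded explicitly.
  -- On a longer one, `b` equal to `a` would identify the first and the last spine vertex.
  last-pendant : {s : Fin (suc r) → Fin n} → Spine K s →
    (∀ k u → ∃ λ w → w ≢ u × adj K (s k) w ≡ true) → ∀ {a} → Pendant K s a fzero →
    ∃ λ b → b ≢ a × (∀ j → b ≢ s j) × Pendant K s b (fromℕ r)
  last-pendant {zero} spine branch {a} _ =
    off-spine-neighbour spine branch fzero a λ { fzero (inj₁ ()) ; fzero (inj₂ ()) }
  last-pendant {suc r} {s} spine@((s-inj , _) , _) branch {a} a-pendant
    with off-spine-neighbour spine branch (fromℕ (suc r)) (s (opposite second)) (λ j p → cong s (near-last j p))
  ... | b , _ , b∉s , b-pendant = b , b≢a , b∉s , b-pendant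
    where
    b≢a : b ≢ a
    b≢a refl = contradiction
      (s-inj fzero (fromℕ (suc r)) (proj₂ b-pendant (s fzero) (proj₁ a-pendant))) λ ()

  -- `cons-path` works at the front only: `a` is attached, the path reversed, `b` attached, and the
  -- result reversed back.
  extend-spine : {s : Fin (suc r) → Fin n} → Spine K s →
    (∀ k u → ∃ λ w → w ≢ u × adj K (s k) w ≡ true) →
    ∃ λ x → InducedPath K x × (∀ k → x (inner k) ≡ s k)
  extend-spine {r} {s} spine@((s-inj , _) , _) branch = x , path-opposite {K = K} path-b , x-inner
    where
    end-a = off-spine-neighbour spine branch fzero (s second) λ j p → cong s (near-first j p)
    a = proj₁ end-a
    a∉s = proj₁ (proj₂ (proj₂ end-a))
    a-pendant = proj₂ (proj₂ (proj₂ end-a))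
    end-b = last-pendant spine branch a-pendant
    b = proj₁ end-b
    b≢a = proj₁ (proj₂ end-b)
    b∉s = proj₁ (proj₂ (proj₂ end-b))
    b-pendant = proj₂ (proj₂ (proj₂ end-b))
    f : Fin (2 + r) → Fin n
    f = cons a s
    path-a : InducedPath K f
    path-a = cons-path (proj₁ spine) a∉s
      (λ i p → cong toℕ (s-inj i fzero (proj₂ a-pendant (s i) p)))
      λ { fzero _ → proj₁ a-pendant }
    adj-b : ∀ i → adj K b (f i) ≡ true → i ≡ fromℕ (suc r)
    adj-b fzero    p = contradiction (proj₂ b-pendant a p) (a∉s (fromℕ r))
    adj-b (fsuc i) p = cong fsuc (s-inj i (fromℕ r) (proj₂ b-pendant (s i) p))
    path-b : InducedPath K (cons b (f ∘ opposite))
    path-b = cons-path (path-opposite {K = K} path-a) (λ i → cons≢ b≢a b∉s (opposite i))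
      (λ i p → cong toℕ (trans (sym (Fin.opposite-involutive i))
        (trans (cong opposite (adj-b (opposite i) p)) (Fin.opposite-involutive fzero))))
      λ { fzero _ → proj₁ b-pendant }
    x : Fin (3 + r) → Fin n
    x = cons b (f ∘ opposite) ∘ opposite
    x-inner : ∀ k → x (inner k) ≡ s k
    x-inner k = trans (cong (cons b (f ∘ opposite) ∘ inject₁) (opposite-inject₁ k))
      (trans (cong f (opposite-inject₁ (opposite k))) (cong s (Fin.opposite-involutive k)))

third-vertex : (v w : Fin (3 + n)) → ∃ λ u → u ≢ v × u ≢ w
third-vertex fzero           fzero           = fsuc fzero , (λ ()) , λ ()
third-vertex fzero           (fsuc fzero)    = fsuc (fsuc fzero) , (λ ()) , λ ()
third-vertex fzero           (fsuc (fsuc w)) = fsuc fzero , (λ ()) , λ ()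
third-vertex (fsuc fzero)    fzero           = fsuc (fsuc fzero) , (λ ()) , λ ()
third-vertex (fsuc fzero)    (fsuc w)        = fzero , (λ ()) , λ ()
third-vertex (fsuc (fsuc v)) fzero           = fsuc fzero , (λ ()) , λ ()
third-vertex (fsuc (fsuc v)) (fsuc w)        = fzero , (λ ()) , λ ()

module _ (G : Graph n) where

  private
    N : Fin n → Subset n
    N v = tabulate (adj G v)
    ∈N⁺ : ∀ {v w} → adj G v w ≡ true → lookup (N v) w ≡ true
    ∈N⁺ {v} {w} = trans (lookup∘tabulate (adj G v) w)
    ∈N⁻ : ∀ {v w} → lookup (N v) w ≡ true → adj G v w ≡ true
    ∈N⁻ {v} {w} = trans (sym (lookup∘tabulate (adj G v) w))

  OnlyNeighbour : Fin n → Fin n → Set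
  OnlyNeighbour v w = adj G v w ≡ true × (∀ u → adj G v u ≡ true → u ≡ w)

  degree≡1⇒ : ∀ {v} → degree G v ≡ 1 → ∃ (OnlyNeighbour v)
  degree≡1⇒ {v} d≡1 = proj₁ w , ∈N⁻ (proj₂ w) ,
    λ u a → cong proj₁ (↔-injective e {u , ∈N⁺ a} {w} (all-equal d≡1 _ _))
    where
    e = VSet↔Fin (N v)
    w = from e (subst Fin (sym d≡1) fzero)
    all-equal : ∀ {k} → k ≡ 1 → (i j : Fin k) → i ≡ j
    all-equal refl fzero fzero = refl

  ⇒degree≡1 : ∀ {v w} → OnlyNeighbour v w → degree G v ≡ 1
  ⇒degree≡1 {v} {w} (a , unique) = ↔⇒≡ (↔-trans (↔-sym (VSet↔Fin (N v))) singleton)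
    where
    singleton : VSet (N v) ↔ Fin 1
    singleton = mk↔ₛ′ (λ _ → fzero {0}) (λ _ → w , ∈N⁺ a) (λ { fzero → refl })
      λ (u , p) → VSet-≡ (N v) (sym (unique u (∈N⁻ p)))

  -- If every neighbour were `u`, then `w` would be `u` and the degree would be 1.
  second-neighbour : ∀ {v w} → degree G v ≢ 1 → adj G v w ≡ true → ∀ u → ∃ λ w → w ≢ u × adj G v w ≡ true
  second-neighbour {v} {w} d≢1 a u with Fin.any? (λ w → ¬? (w ≟ u) ×-dec (adj G v w Bool.≟ true))
  ... | yes p = p
  ... | no ¬p = contradiction (⇒degree≡1 (subst (λ z → adj G v z ≡ true) (only w a) a , only)) d≢1
    where
    only : ∀ w → adj G v w ≡ true → w ≡ u
    only w a with w ≟ u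
    ... | yes e = e
    ... | no ¬e = contradiction (w , ¬e , a) ¬p

  nonLeaf⁺ : ∀ {v} → degree G v ≢ 1 → lookup (nonLeaves G) v ≡ true
  nonLeaf⁺ {v} d≢1 = trans (lookup∘tabulate _ v) lemma
    where
    lemma : not ⌊ degree G v ℕ.≟ 1 ⌋ ≡ true
    lemma with degree G v ℕ.≟ 1
    ... | yes d≡1 = contradiction d≡1 d≢1
    ... | no _    = refl

  nonLeaf⁻ : ∀ {v} → lookup (nonLeaves G) v ≡ true → degree G v ≢ 1
  nonLeaf⁻ {v} p with degree G v ℕ.≟ 1 | trans (sym (lookup∘tabulate _ v)) p
  ... | no d≢1 | _ = d≢1

  module _ (connected : Connected G) where

    has-neighbour : ∀ {v u} → u ≢ v → ∃ λ w → adj G v w ≡ true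
    has-neighbour {v} {u} u≢v with connected v u
    ... | zero  , w , w0 , wk , _    = contradiction (trans (sym wk) w0) u≢v
    ... | suc k , w , w0 , wk , step =
      w (fsuc fzero) , subst (λ x → adj G x (w (fsuc fzero)) ≡ true) w0 (step fzero)

    -- Two adjacent leaves would form a component of their own.
    leaves-nonadjacent : ∀ {v w u} → OnlyNeighbour v w → OnlyNeighbour w v → u ≢ v → u ≢ w → ⊥
    leaves-nonadjacent {v} {w} {u} (_ , v-only) (_ , w-only) u≢v u≢w with connected v u
    ... | k , walk , w0 , wk , step with <-weakInduction (λ i → walk i ≡ v ⊎ walk i ≡ w) (inj₁ w0) stays (fromℕ k)
      where
      stays : ∀ i → walk (inject₁ i) ≡ v ⊎ walk (inject₁ i) ≡ w → walk (fsuc i) ≡ v ⊎ walk (fsuc i) ≡ w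
      stays i (inj₁ e) = inj₂ (v-only _ (subst (λ x → adj G x (walk (fsuc i)) ≡ true) e (step i)))
      stays i (inj₂ e) = inj₁ (w-only _ (subst (λ x → adj G x (walk (fsuc i)) ≡ true) e (step i)))
    ...   | inj₁ e = u≢v (trans (sym wk) e)
    ...   | inj₂ e = u≢w (trans (sym wk) e)

-- A vertex off the spine has degree 1, and its neighbour is no leaf, as two adjacent leaves would
-- be cut off from a third vertex. A spine vertex always has a neighbour besides any given one, so a
-- leaf can be added at both ends.
caterpillar-path : ∀ (G : Graph n) → IsCaterpillar G → 3 ≤ n →
  ∃ λ (x : Fin (2 + ∣ nonLeaves G ∣) → Fin n) → InducedPath G x × Spine G (x ∘ inner)
caterpillar-path {suc (suc (suc n))} G ((connected , _) , p , near⇔) (s≤s (s≤s (s≤s z≤n))) =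
  -- The vertex `fzero` lies on the spine or hangs from it; either way an index exists, so the spine
  -- is not empty.
  extend s spine branch (Sum.[ proj₁ , proj₁ ]′ (cover fzero))
  where
  s : Fin ∣ nonLeaves G ∣ → Fin (3 + n)
  s k = proj₁ (to p k)
  neighbour : ∀ v → ∃ λ w → adj G v w ≡ true
  neighbour v = has-neighbour G connected (proj₁ (proj₂ (third-vertex v v)))
  nonleaf-on-spine : ∀ {v} → degree G v ≢ 1 → ∃ λ k → v ≡ s k
  nonleaf-on-spine {v} d≢1 = from p (v , nonLeaf⁺ G d≢1) ,
    cong proj₁ (sym (strictlyInverseˡ p (v , nonLeaf⁺ G d≢1)))
  cover : ∀ v → (∃ λ k → v ≡ s k) ⊎ ∃ (Pendant G s v)
  cover v with degree G v ℕ.≟ 1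
  ... | no d≢1 = inj₁ (nonleaf-on-spine d≢1)
  ... | yes d≡1 with degree≡1⇒ G d≡1
  ...   | w , v-w , v-only with degree G w ℕ.≟ 1
  ...     | no d≢1 = inj₂ (proj₁ (nonleaf-on-spine d≢1) ,
              subst (OnlyNeighbour G v) (proj₂ (nonleaf-on-spine d≢1)) (v-w , v-only))
  ...     | yes w≡1 with degree≡1⇒ G w≡1 | third-vertex v w
  ...       | v′ , w-v′ , w-only | u , u≢v , u≢w = ⊥-elim (leaves-nonadjacent G connected
                (v-w , v-only) (w-v , λ z a → trans (w-only z a) (sym (w-only v w-v))) u≢v u≢w)
    where
    w-v : adj G w v ≡ true
    w-v = flip-adj {K = G} v-w
  spine : Spine G s
  spine = ((λ i j e → ↔-injective p (VSet-≡ (nonLeaves G) e)) ,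
           (λ i j → Equivalence.to (near⇔ i j)) , (λ i j → Equivalence.from (near⇔ i j))) , cover
  branch : ∀ k u → ∃ λ w → w ≢ u × adj G (s k) w ≡ true
  branch k = second-neighbour G (nonLeaf⁻ G (proj₂ (to p k))) (proj₂ (neighbour (s k)))
  -- The length is generalised to `r` so that the index can force it to be a successor.
  extend : ∀ {r} (s : Fin r → Fin (3 + n)) → Spine G s →
    (∀ k u → ∃ λ w → w ≢ u × adj G (s k) w ≡ true) → Fin r →
    ∃ λ (x : Fin (2 + r) → Fin (3 + n)) → InducedPath G x × Spine G (x ∘ inner)
  extend {suc r} s spine branch _ with extend-spine {K = G} spine branch
  ... | x , path , e = x , path , spine-cong {K = G} (sym ∘ e) spine

-- The legs determine the graph

legSet : (K : Graph n) (s : Fin r → Fin n) → Fin r → Subset n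
legSet K s k = comprehension (leg? K s k)

Parts : (K : Graph n) (s : Fin r → Fin n) → Set
Parts {r = r} K s = Fin r ⊎ Σ (Fin r) λ k → VSet (legSet K s k)

shape : (K : Graph n) (s : Fin r → Fin n) → Parts K s → Fin r ⊎ Fin r
shape K s (inj₁ k)       = inj₁ k
shape K s (inj₂ (k , _)) = inj₂ k

-- Left stands for a spine vertex, right for a leg at that position. Legs at one position are
-- interchangeable, so kind and position decide adjacency.
shapeAdj : Fin r ⊎ Fin r → Fin r ⊎ Fin r → Bool
shapeAdj (inj₁ i) (inj₁ j) = does (near? i j)
shapeAdj (inj₁ i) (inj₂ k) = does (i ≟ k)
shapeAdj (inj₂ k) (inj₁ i) = does (i ≟ k)
shapeAdj (inj₂ k) (inj₂ l) = false

module _ {K : Graph n} {s : Fin r → Fin n} (spine : Spine K s) where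

  private
    s-inj    = proj₁ (proj₁ spine)
    adj⇒near = proj₁ (proj₂ (proj₁ spine))
    near⇒adj = proj₂ (proj₂ (proj₁ spine))

  vertex : Parts K s → Fin n
  vertex (inj₁ k)           = s k
  vertex (inj₂ (_ , v , _)) = v

  private
    isLeg : ∀ k (x : VSet (legSet K s k)) → Leg K s k (proj₁ x)
    isLeg k x = ∈-comprehension⁻ (leg? K s k) (proj₂ x)

    isPendant : ∀ k (x : VSet (legSet K s k)) → Pendant K s (proj₁ x) k
    isPendant k x = off-spine⇒pendant {K = K} spine (proj₂ (isLeg k x)) (proj₁ (isLeg k x))

  -- A pendant vertex has one neighbour, so it cannot be a leg at two positions.
  vertex-injective : ∀ d e → vertex d ≡ vertex e → d ≡ e
  vertex-injective (inj₁ k)       (inj₁ l)       p = cong inj₁ (s-inj k l p)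
  vertex-injective (inj₁ k)       (inj₂ (l , x)) p = contradiction (sym p) (proj₂ (isLeg l x) k)
  vertex-injective (inj₂ (k , x)) (inj₁ l)       p = contradiction p (proj₂ (isLeg k x) l)
  vertex-injective (inj₂ (k , x)) (inj₂ (l , y)) refl
    with s-inj l k (proj₂ (isPendant k x) (s l) (proj₁ (isPendant l y)))
  ... | refl = cong (λ z → inj₂ (k , z)) (VSet-≡ (legSet K s k) refl)

  part : ∀ v → ∃ λ d → vertex d ≡ v
  -- Membership in the spine is tested first, because `Spine` allows a spine vertex to be pendant as
  -- well.
  part v with Fin.any? (λ k → v ≟ s k)
  ... | yes (k , v≡) = inj₁ k , sym v≡
  ... | no v∉s with proj₂ spine v
  ...   | inj₁ p           = contradiction p v∉s
  ...   | inj₂ (k , a , _) = inj₂ (k , v , ∈-comprehension⁺ (leg? K s k)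
            (flip-adj {K = K} a , λ j v≡ → v∉s (j , v≡))) , refl

  parts↔ : Fin n ↔ Parts K s
  parts↔ = mk↔ₛ′ (proj₁ ∘ part) vertex
    (λ d → vertex-injective _ d (proj₂ (part (vertex d)))) (proj₂ ∘ part)

  private
    spine-leg : ∀ i k (x : VSet (legSet K s k)) → adj K (s i) (proj₁ x) ≡ does (i ≟ k)
    spine-leg i k x = bool-ext
      (λ a → dec-true (i ≟ k) (s-inj i k (proj₂ (isPendant k x) (s i) (flip-adj {K = K} a))))
      (λ e → subst (λ j → adj K (s j) (proj₁ x) ≡ true) (sym (does⁻ (i ≟ k) e)) (proj₁ (isLeg k x)))

  adj-vertex : ∀ d e → adj K (vertex d) (vertex e) ≡ shapeAdj (shape K s d) (shape K s e)
  adj-vertex (inj₁ i) (inj₁ j) =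
    bool-ext (λ a → dec-true (near? i j) (adj⇒near i j a)) λ e → near⇒adj i j (does⁻ (near? i j) e)
  adj-vertex (inj₁ i) (inj₂ (k , x)) = spine-leg i k x
  adj-vertex (inj₂ (k , x)) (inj₁ i) = trans (adj-sym K _ _) (spine-leg i k x)
  adj-vertex (inj₂ (k , x)) (inj₂ (l , y)) =
    bool-ext (λ a → contradiction (proj₂ (isPendant k x) _ a) (proj₂ (isLeg l y) k)) λ ()

∣legSet∣ : (K : Graph n) (s : Fin r → Fin n) (k : Fin r) → legs K s k ≡ ∣ legSet K s k ∣
∣legSet∣ K s k = ∑-allFin-⟦⟧ (does ∘ leg? K s k)

-- Legs at one position can be matched in any way, since adjacency sees only the `shape`.
sameLegs⇒isomorphic : {G : Graph n} {H : Graph m} {s : Fin r → Fin n} {t : Fin r → Fin m} →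
  Spine G s → Spine H t → (∀ k → legs G s k ≡ legs H t k) → Isomorphic G H
sameLegs⇒isomorphic {r = r} {G} {H} {s} {t} S T same =
  ↔-trans (parts↔ S) (↔-trans match (↔-sym (parts↔ T))) , preserves
  where
  e : ∀ k → VSet (legSet G s k) ↔ VSet (legSet H t k)
  e k = ↔-trans (VSet↔Fin (legSet G s k)) (subst (λ c → Fin c ↔ VSet (legSet H t k))
    (trans (sym (∣legSet∣ H t k)) (trans (sym (same k)) (∣legSet∣ G s k)))
    (↔-sym (VSet↔Fin (legSet H t k))))
  match : Parts G s ↔ Parts H t
  match = mk↔ₛ′
    (λ { (inj₁ k) → inj₁ k ; (inj₂ (k , x)) → inj₂ (k , to (e k) x) })
    (λ { (inj₁ k) → inj₁ k ; (inj₂ (k , x)) → inj₂ (k , from (e k) x) })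
    (λ { (inj₁ k) → refl ; (inj₂ (k , x)) → cong (λ y → inj₂ (k , y)) (strictlyInverseˡ (e k) x) })
    (λ { (inj₁ k) → refl ; (inj₂ (k , x)) → cong (λ y → inj₂ (k , y)) (strictlyInverseʳ (e k) x) })
  shape-match : ∀ d → shape G s d ≡ shape H t (to match d)
  shape-match (inj₁ k) = refl
  shape-match (inj₂ _) = refl
  preserves : ∀ u v → adj G u v ≡ adj H (vertex T (to match (to (parts↔ S) u)))
                                        (vertex T (to match (to (parts↔ S) v)))
  preserves u v = begin
    adj G u v
      ≡⟨ cong₂ (adj G) (proj₂ (part S u)) (proj₂ (part S v)) ⟨
    adj G (vertex S d) (vertex S d′)
      ≡⟨ adj-vertex S d d′ ⟩
    shapeAdj (shape G s d) (shape G s d′)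
      ≡⟨ cong₂ shapeAdj (shape-match d) (shape-match d′) ⟩
    shapeAdj (shape H t (to match d)) (shape H t (to match d′))
      ≡⟨ adj-vertex T (to match d) (to match d′) ⟨
    adj H (vertex T (to match d)) (vertex T (to match d′)) ∎
    where
    open ≡-Reasoning
    d d′ : Parts G s
    d  = to (parts↔ S) u
    d′ = to (parts↔ S) v

-- Recovering a pair of reflected sequences from its moments

-- With a′ and b′ eliminated through the two sums, the mixed moments say that
-- (a − x)(b − y′) + (a − x′)(b − y) vanishes.
mixed-moment : ∀ a a′ x x′ b b′ y y′ → a ℤ.+ a′ ≡ x ℤ.+ x′ → b ℤ.+ b′ ≡ y ℤ.+ y′ →
  a ℤ.* b ℤ.+ a′ ℤ.* b′ ≡ x ℤ.* y ℤ.+ x′ ℤ.* y′ →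
  (a ℤ.- x) ℤ.* (b ℤ.- y′) ℤ.+ (a ℤ.- x′) ℤ.* (b ℤ.- y) ≡ pos 0
mixed-moment a a′ x x′ b b′ y y′ sa sb m = begin
  (a ℤ.- x) ℤ.* (b ℤ.- y′) ℤ.+ (a ℤ.- x′) ℤ.* (b ℤ.- y)
    ≡⟨ expand a x x′ b y y′ ⟩
  a ℤ.* b ℤ.+ ((x ℤ.+ x′) ℤ.- a) ℤ.* ((y ℤ.+ y′) ℤ.- b) ℤ.- (x ℤ.* y ℤ.+ x′ ℤ.* y′)
    ≡⟨ cong₂ (λ u v → a ℤ.* b ℤ.+ u ℤ.* v ℤ.- (x ℤ.* y ℤ.+ x′ ℤ.* y′)) (eliminate a a′ _ sa) (eliminate b b′ _ sb) ⟩
  a ℤ.* b ℤ.+ a′ ℤ.* b′ ℤ.- (x ℤ.* y ℤ.+ x′ ℤ.* y′)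
    ≡⟨ cong (ℤ._- (x ℤ.* y ℤ.+ x′ ℤ.* y′)) m ⟩
  (x ℤ.* y ℤ.+ x′ ℤ.* y′) ℤ.- (x ℤ.* y ℤ.+ x′ ℤ.* y′)
    ≡⟨ ℤ.+-inverseʳ (x ℤ.* y ℤ.+ x′ ℤ.* y′) ⟩
  pos 0 ∎
  where
  open ≡-Reasoning
  expand : ∀ a x x′ b y y′ → (a ℤ.- x) ℤ.* (b ℤ.- y′) ℤ.+ (a ℤ.- x′) ℤ.* (b ℤ.- y) ≡
    a ℤ.* b ℤ.+ ((x ℤ.+ x′) ℤ.- a) ℤ.* ((y ℤ.+ y′) ℤ.- b) ℤ.- (x ℤ.* y ℤ.+ x′ ℤ.* y′)
  expand = ℤRing.solve-∀
  cancel : ∀ a a′ → (a ℤ.+ a′) ℤ.- a ≡ a′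
  cancel = ℤRing.solve-∀
  eliminate : ∀ a a′ c → a ℤ.+ a′ ≡ c → c ℤ.- a ≡ a′
  eliminate a a′ c refl = cancel a a′

-- Put u = α − β and v = α − β ∘ σ.  The mixed moments give uᵢ vⱼ + vᵢ uⱼ = 0, so
-- if uᵢ ≠ 0 for some i, then j = i yields vᵢ = 0 and hence all vⱼ = 0.
two-points : ∀ {r} (σ : Fin r → Fin r) (α β : Fin r → ℕ) →
  (∀ i → α i + α (σ i) ≡ β i + β (σ i)) →
  (∀ i j → α i * α j + α (σ i) * α (σ j) ≡ β i * β j + β (σ i) * β (σ j)) →
  (∀ i → α i ≡ β i) ⊎ (∀ i → α i ≡ β (σ i))
two-points {r} σ α β first second with Fin.all? (λ i → α i ℕ.≟ β i)
... | yes α≡β = inj₁ α≡β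
... | no α≢β with Fin.¬∀⟶∃¬ r _ (λ i → α i ℕ.≟ β i) α≢β
...   | i , αi≢βi = inj₂ λ j → ℤ.+-injective (ℤ.i-j≡0⇒i≡j (pos (α j)) (pos (β (σ j))) (v≡0 j))
  where
  a b a′ b′ : Fin r → ℤ
  a k = pos (α k)
  b k = pos (β k)
  a′ k = pos (α (σ k))
  b′ k = pos (β (σ k))
  mixed : ∀ j k → (a j ℤ.- b j) ℤ.* (a k ℤ.- b′ k) ℤ.+ (a j ℤ.- b′ j) ℤ.* (a k ℤ.- b k) ≡ pos 0
  mixed j k = mixed-moment (a j) (a′ j) (b j) (b′ j) (a k) (a′ k) (b k) (b′ k)
    (cong pos (first j)) (cong pos (first k)) (trans (sym (cast (α j) (α k) (α (σ j)) (α (σ k))))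
      (trans (cong pos (second j k)) (cast (β j) (β k) (β (σ j)) (β (σ k)))))
    where
    cast : ∀ w x y z → pos (w * x + y * z) ≡ pos w ℤ.* pos x ℤ.+ pos y ℤ.* pos z
    cast w x y z = trans (ℤ.pos-+ (w * x) (y * z)) (cong₂ ℤ._+_ (ℤ.pos-* w x) (ℤ.pos-* y z))
  nonzero : ∀ {z} → (a i ℤ.- b i) ℤ.* z ≡ pos 0 → z ≡ pos 0
  nonzero e with ℤ.i*j≡0⇒i≡0∨j≡0 (a i ℤ.- b i) e
  ... | inj₁ p = contradiction (ℤ.+-injective (ℤ.i-j≡0⇒i≡j (a i) (b i) p)) αi≢βi
  ... | inj₂ p = p
  double : ∀ u v → u ℤ.* (v ℤ.+ v) ≡ u ℤ.* v ℤ.+ v ℤ.* u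
  double = ℤRing.solve-∀
  half : ∀ {z} → z ℤ.+ z ≡ pos 0 → z ≡ pos 0
  half {pos 0} e = refl
  vᵢ≡0 : a i ℤ.- b′ i ≡ pos 0
  vᵢ≡0 = half (nonzero (trans (double (a i ℤ.- b i) (a i ℤ.- b′ i)) (mixed i i)))
  v≡0 : ∀ j → a j ℤ.- b′ j ≡ pos 0
  v≡0 j = nonzero (trans (sym (ℤ.+-identityʳ _))
    (trans (cong (λ v → (a i ℤ.- b i) ℤ.* (a j ℤ.- b′ j) ℤ.+ v ℤ.* (a j ℤ.- b j)) (sym vᵢ≡0)) (mixed i j)))

-- Moments of the leg counts

drop2 : ∀ {A : Set} → (Fin (2 + q) → A) → Fin q → A
drop2 f i = f (fsuc (fsuc i))

-- nothing stands for an unconstrained vertex, so that first and second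
-- moments are instances of the same count.
LegAt : Graph n → (Fin r → Fin n) → Maybe (Fin r) → Fin n → Set
LegAt K s nothing  v = ⊤
LegAt K s (just k) v = Leg K s k v

legAt? : (K : Graph n) (s : Fin r → Fin n) (a : Maybe (Fin r)) (v : Fin n) → Dec (LegAt K s a v)
legAt? K s nothing  v = yes tt
legAt? K s (just k) v = leg? K s k v

legsAt : Graph n → (Fin r → Fin n) → Maybe (Fin r) → ℕ
legsAt {n} K s a = ∑ (allFin n) λ v → ⟦ does (legAt? K s a v) ⟧

-- The first two entries are the marked vertices. They may coincide with each other or with the ends
-- of the path, which keeps the two choices independent.
Configuration : Graph n → (a b : Maybe (Fin r)) → (Fin (4 + r) → Fin n) → Set
Configuration K a b f = InducedPath K (drop2 f) ×
  LegAt K (drop2 f ∘ inner) a (f fzero) × LegAt K (drop2 f ∘ inner) b (f (fsuc fzero))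

configuration? : (K : Graph n) (a b : Maybe (Fin r)) (f : Fin (4 + r) → Fin n) → Dec (Configuration K a b f)
configuration? K a b f = inducedPath? K (drop2 f) ×-dec
  legAt? K (drop2 f ∘ inner) a (f fzero) ×-dec legAt? K (drop2 f ∘ inner) b (f (fsuc fzero))

pattern-path : {G : Graph n} {H : Graph m} {f : Fin q → Fin n} {g : Fin q → Fin m} →
  SamePattern G H f g → (e : Fin p → Fin q) → InducedPath G (f ∘ e) → InducedPath H (g ∘ e)
pattern-path (samePattern adj-≡ eq⁺ eq⁻) e (inj , adj⇒near , near⇒adj) =
  (λ i j p → inj i j (eq⁻ _ _ p)) ,
  (λ i j p → adj⇒near i j (trans (adj-≡ _ _) p)) ,
  (λ i j p → trans (sym (adj-≡ _ _)) (near⇒adj i j p))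

pattern-legAt : {G : Graph n} {H : Graph m} {f : Fin q → Fin n} {g : Fin q → Fin m} →
  SamePattern G H f g → (e : Fin r → Fin q) (a : Maybe (Fin r)) (i : Fin q) →
  LegAt G (f ∘ e) a (f i) → LegAt H (g ∘ e) a (g i)
pattern-legAt pat e nothing  i _ = tt
pattern-legAt (samePattern adj-≡ eq⁺ eq⁻) e (just k) i (a , off) =
  trans (sym (adj-≡ _ _)) a , λ j p → off j (eq⁻ _ _ p)

pattern-configuration : {G : Graph n} {H : Graph m} {f : Fin (4 + r) → Fin n} {g : Fin (4 + r) → Fin m} →
  SamePattern G H f g → (a b : Maybe (Fin r)) → Configuration G a b f → Configuration H a b g
pattern-configuration {G = G} {H} pat a b (path , at-a , at-b) =
  pattern-path pat (drop2 id) path ,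
  pattern-legAt {G = G} {H} pat (drop2 id ∘ inner) a fzero at-a ,
  pattern-legAt {G = G} {H} pat (drop2 id ∘ inner) b (fsuc fzero) at-b

isPath : (K : Graph n) → Vec (Fin n) q → ℕ
isPath K x = ⟦ does (inducedPath? K (lookup x)) ⟧

innerLegs : Graph n → Vec (Fin n) (2 + r) → Maybe (Fin r) → ℕ
innerLegs K x = legsAt K (lookup x ∘ inner)

moment : ∀ {r} → Graph n → Maybe (Fin r) → Maybe (Fin r) → ℕ
moment {n} {r} K a b = ∑ (vecs n (2 + r)) λ x → isPath K x * (innerLegs K x a * innerLegs K x b)

∑-configurations : (K : Graph n) (a b : Maybe (Fin r)) →
  ∑ (vecs n (4 + r)) (λ t → ⟦ does (configuration? K a b (lookup t)) ⟧) ≡ moment K a b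
∑-configurations {n} {r} K a b = ∑-vecs-2+ n (2 + r) (isPath K)
  (λ x z → ⟦ does (legAt? K (lookup x ∘ inner) a z) ⟧)
  (λ x w → ⟦ does (legAt? K (lookup x ∘ inner) b w) ⟧)
  λ z w x → trans (⟦∧⟧ (does (inducedPath? K (lookup x))) _)
    (cong (isPath K x *_) (⟦∧⟧ (does (legAt? K (lookup x ∘ inner) a z)) _))

numPaths : Graph n → ℕ → ℕ
numPaths {n} K q = ∑ (vecs n q) (isPath K)

symmetric : (Maybe (Fin r) → ℕ) → Maybe (Fin r) → Maybe (Fin r) → ℕ
symmetric α a b = α a * α b + α (Maybe.map opposite a) * α (Maybe.map opposite b)

-- Every induced path with 2 + r vertices runs along the spine in one of the two
-- directions, and the symmetrised product does not see the direction.
moment-symmetric : {K : Graph n} {s : Fin r → Fin n} → Spine K s → ∀ a b →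
  moment K a b + moment K (Maybe.map opposite a) (Maybe.map opposite b)
    ≡ numPaths K (2 + r) * symmetric (legsAt K s) a b
moment-symmetric {n} {r} {K} {s} spine a b = begin
  moment K a b + moment K a′ b′
    ≡⟨ ∑-+ V (term a b) (term a′ b′) ⟨
  ∑ V (λ x → term a b x + term a′ b′ x)
    ≡⟨ ∑-cong V constant ⟩
  ∑ V (λ x → isPath K x * C)
    ≡⟨ ∑-*ʳ V C (isPath K) ⟩
  numPaths K (2 + r) * C ∎
  where
  open ≡-Reasoning
  V = vecs n (2 + r)
  a′ = Maybe.map opposite a
  b′ = Maybe.map opposite b
  C = symmetric (legsAt K s) a b
  term : Maybe (Fin r) → Maybe (Fin r) → Vec (Fin n) (2 + r) → ℕ
  term a b x = isPath K x * (innerLegs K x a * innerLegs K x b)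
  on-maybe : ∀ {α β : Maybe (Fin r) → ℕ} → α nothing ≡ β nothing → (∀ k → α (just k) ≡ β (just k)) →
             ∀ a → α a ≡ β a
  on-maybe e f nothing  = e
  on-maybe e f (just k) = f k
  -- A tuple that is not a path has weight 0, so the equation is asked for on paths only.
  weighted : ∀ {A : Set} (a? : Dec A) {x y z} → (A → x + y ≡ z) →
             ⟦ does a? ⟧ * x + ⟦ does a? ⟧ * y ≡ ⟦ does a? ⟧ * z
  weighted (no _)  e = refl
  weighted (yes a) {x} {y} e = trans (sym (ℕ.*-distribˡ-+ 1 x y)) (cong (1 *_) (e a))
  opposite² : ∀ a → Maybe.map opposite (Maybe.map opposite a) ≡ a
  opposite² nothing  = refl
  opposite² (just k) = cong just (Fin.opposite-involutive k)
  constant : ∀ x → term a b x + term a′ b′ x ≡ isPath K x * C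
  constant x = weighted (inducedPath? K (lookup x)) λ path → case legs-rigid {K = K} spine path of λ where
    (inj₁ same) → let e = on-maybe {innerLegs K x} {legsAt K s} refl same in
      cong₂ _+_ (cong₂ _*_ (e a) (e b)) (cong₂ _*_ (e a′) (e b′))
    -- Reflecting twice returns the original mark, so the two products trade places.
    (inj₂ reversed) → let e = on-maybe {innerLegs K x} {legsAt K s ∘ Maybe.map opposite} refl reversed
                          e′ = λ a → trans (e (Maybe.map opposite a)) (cong (legsAt K s) (opposite² a)) in
      trans (cong₂ _+_ (cong₂ _*_ (e a) (e b)) (cong₂ _*_ (e′ a) (e′ b)))
            (ℕ.+-comm (legsAt K s a′ * legsAt K s b′) _)

-- Transfer to a graph with the same deck, and reconstruction

module _ {G H : Graph n} (ψ : Vec (Fin n) (4 + r) ↔ Vec (Fin n) (4 + r))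
         (pat : ∀ t → SamePattern G H (lookup t) (lookup (to ψ t))) where

  -- Being a configuration depends only on adjacency and equality among the entries, so `ψ`
  -- preserves and reflects it.
  moment-≡ : (a b : Maybe (Fin r)) → moment G a b ≡ moment H a b
  moment-≡ a b = trans (sym (∑-configurations G a b)) (trans
    (∑-vecs-↔ ψ λ t → cong ⟦_⟧ (does-⇔ (mk⇔
      (pattern-configuration {G = G} {H} (pat t) a b)
      (pattern-configuration {G = H} {G} (SamePattern-sym (pat t)) a b))
      (configuration? G a b (lookup t)) (configuration? H a b (lookup (to ψ t)))))
    (∑-configurations H a b))

  transfer-path : {x : Fin (2 + r) → Fin n} → InducedPath G x → ∃ λ y → InducedPath H (lookup y)
  transfer-path {x} path = tabulate y ,
    path-cong {K = H} {f = y} (λ i → sym (lookup∘tabulate y i))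
      (pattern-path (pat (tabulate padded)) (drop2 id)
        (path-cong {K = G} {f = x} (λ i → sym (lookup∘tabulate padded (fsuc (fsuc i)))) path))
    where
    -- Two extra copies of the first vertex fill the tuple up to the length on which `ψ` acts.
    padded : Fin (4 + r) → Fin n
    padded = cons (x fzero) (cons (x fzero) x)
    y : Fin (2 + r) → Fin n
    y = drop2 (lookup (to ψ (tabulate padded)))

  -- For each pair `v`, `w` the tuple formed with `y` is pulled back to `G`, where the inner part of
  -- the path is a spine; what holds there of the preimage of `v` is pushed forward. Different pairs
  -- may pull `y` back to different paths.
  transfer-spine : {s : Fin r → Fin n} → Spine G s → (y : Vec (Fin n) (2 + r)) →
    InducedPath H (lookup y) → Spine H (lookup y ∘ inner)
  transfer-spine spine y path-y = path-inner {K = H} path-y , cover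
    where
    t : Fin r → Fin n
    t = lookup y ∘ inner
    preimage : ∀ v w → Vec (Fin n) (4 + r)
    preimage v w = from ψ (v ∷ w ∷ y)
    same : ∀ v w → SamePattern G H (lookup (preimage v w)) (lookup (v ∷ w ∷ y))
    same v w = subst (λ u → SamePattern G H (lookup (preimage v w)) (lookup u))
      (strictlyInverseˡ ψ (v ∷ w ∷ y)) (pat (preimage v w))
    -- The middle conjunct makes k depend on v only, which glues the pairs (v , w) over all w.
    local : ∀ v w → (∃ λ k → v ≡ t k) ⊎ ∃ λ k → adj H v (t k) ≡ true ×
      (∀ j → adj H v (t j) ≡ true → j ≡ k) × (adj H v w ≡ true → w ≡ t k)
    local v w with proj₂ (path⇒spine {K = G} spine (pattern-path (SamePattern-sym (same v w)) (drop2 id) path-y))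
                     (lookup (preimage v w) fzero)
    ... | inj₁ (k , v≡) = inj₁ (k , SamePattern.eq⁺ (same v w) fzero (fsuc (fsuc (inner k))) v≡)
    ... | inj₂ (k , v-k , unique) = inj₂ (k ,
      trans (sym (SamePattern.adj-≡ (same v w) fzero (fsuc (fsuc (inner k))))) v-k ,
      (λ j v-j → proj₁ (path-inner {K = H} path-y) j k (only (fsuc (fsuc (inner j))) v-j)) ,
      only (fsuc fzero))
      where
      only : ∀ i → adj H v (lookup (v ∷ w ∷ y) i) ≡ true → lookup (v ∷ w ∷ y) i ≡ t k
      only i v-i = SamePattern.eq⁺ (same v w) i (fsuc (fsuc (inner k)))
        (unique _ (trans (SamePattern.adj-≡ (same v w) fzero i) v-i))
    cover : ∀ v → (∃ λ k → v ≡ t k) ⊎ ∃ (Pendant H t v)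
    cover v with Fin.any? (λ k → v ≟ t k)
    ... | yes on = inj₁ on
    -- Any second vertex would do for finding `k`; `v` itself is at hand.
    ... | no off with local v v
    ...   | inj₁ on = inj₁ on
    ...   | inj₂ (k , v-k , only , _) = inj₂ (k , v-k , unique)
      where
      unique : ∀ w → adj H v w ≡ true → w ≡ t k
      unique w v-w with local v w
      ... | inj₁ on = contradiction on off
      ... | inj₂ (j , v-j , _ , w≡) = trans (w≡ v-w) (cong t (only j v-j))

-- The symmetrised moments give the symmetrised products up to the factor `numPaths`. Leaving both
-- marks free shows this factor to be the same for both graphs; after cancelling it, one free mark
-- yields the sums and two fixed marks the products for `two-points`.
sameMoments⇒isomorphic : {G H : Graph n} {s t : Fin r → Fin n} → Spine G s → Spine H t → 1 ≤ n →
  1 ≤ numPaths G (2 + r) → (∀ (a b : Maybe (Fin r)) → moment G a b ≡ moment H a b) → Isomorphic G H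
sameMoments⇒isomorphic {n} {r} {G} {H} {s} {t} S T 1≤n 1≤paths same =
  case two-points opposite α β first (λ i j → symmetric-≡ (just i) (just j)) of λ where
    (inj₁ α≡β)  → sameLegs⇒isomorphic {G = G} {H} S T α≡β
    (inj₂ α≡β′) → sameLegs⇒isomorphic {G = G} {H} S (spine-opposite {K = H} T)
                    λ k → trans (α≡β′ k) (sym (legs-opposite {K = H} t k))
  where
  α β : Fin r → ℕ
  α = legs G s
  β = legs H t
  -- The number of vertices, in the form to which `legsAt G s nothing` and `legsAt H t nothing`
  -- reduce.
  order = ∑ (allFin n) λ _ → 1
  instance
    order≢0 : NonZero order
    order≢0 = >-nonZero (n≤order 1≤n)
      where
      n≤order : ∀ {n} → 1 ≤ n → 1 ≤ ∑ (allFin n) λ _ → 1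
      n≤order (s≤s _) = s≤s z≤n
  scaled : ∀ a b → numPaths G (2 + r) * symmetric (legsAt G s) a b ≡ numPaths H (2 + r) * symmetric (legsAt H t) a b
  scaled a b = trans (sym (moment-symmetric {K = G} S a b))
    (trans (cong₂ _+_ (same a b) (same (Maybe.map opposite a) (Maybe.map opposite b))) (moment-symmetric {K = H} T a b))
  square≢0 : NonZero (order * order + order * order)
  square≢0 = >-nonZero (ℕ.≤-trans (ℕ.*-mono-≤ (>-nonZero⁻¹ order) (>-nonZero⁻¹ order)) (ℕ.m≤m+n _ _))
  -- With both marks free the symmetrised product is `order * order + order * order` for either
  -- graph.
  numPaths-≡ : numPaths G (2 + r) ≡ numPaths H (2 + r)
  numPaths-≡ = ℕ.*-cancelʳ-≡ _ _ (order * order + order * order) {{square≢0}} (scaled nothing nothing)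
  symmetric-≡ : ∀ a b → symmetric (legsAt G s) a b ≡ symmetric (legsAt H t) a b
  symmetric-≡ a b = ℕ.*-cancelˡ-≡ _ _ (numPaths G (2 + r)) {{>-nonZero 1≤paths}}
    (trans (scaled a b) (cong (_* symmetric (legsAt H t) a b) (sym numPaths-≡)))
  first : ∀ i → α i + α (opposite i) ≡ β i + β (opposite i)
  first i = ℕ.*-cancelʳ-≡ _ _ order (trans (ℕ.*-distribʳ-+ order (α i) (α (opposite i)))
    (trans (symmetric-≡ (just i) nothing) (sym (ℕ.*-distribʳ-+ order (β i) (β (opposite i))))))

-- The path `x` serves twice: it makes the number of paths positive, and its transfer to `H`
-- provides a spine there.
sameDeck⇒isomorphic : {G H : Graph n} → SameDeck G H → 1 ≤ n → 2 * (4 + r) ≤ n + 2 →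
  (x : Fin (2 + r) → Fin n) → InducedPath G x → Spine G (x ∘ inner) → Isomorphic G H
sameDeck⇒isomorphic {n} {r} {G} {H} deck 1≤n small x path spine =
  sameMoments⇒isomorphic {G = G} {H} spine
    (transfer-spine {G = G} {H} ψ pat spine (proj₁ path-H) (proj₂ path-H)) 1≤n
    (1≤numPaths (tabulate x) (path-cong {K = G} {f = x} (λ i → sym (lookup∘tabulate x i)) path))
    (moment-≡ {G = G} {H} ψ pat)
  where
  ψ : Vec (Fin n) (4 + r) ↔ Vec (Fin n) (4 + r)
  ψ = proj₁ (tuples↔ {G = G} {H} deck small small)
  pat : ∀ t → SamePattern G H (lookup t) (lookup (to ψ t))
  pat = proj₂ (tuples↔ {G = G} {H} deck small small)
  path-H : ∃ λ y → InducedPath H (lookup y)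
  path-H = transfer-path {G = G} {H} ψ pat path
  1≤numPaths : ∀ (z : Vec (Fin n) (2 + r)) → InducedPath G (lookup z) → 1 ≤ numPaths G (2 + r)
  1≤numPaths z p = subst (_≤ numPaths G (2 + r))
    (cong ⟦_⟧ (dec-true (inducedPath? G (lookup z)) p)) (term≤∑ (isPath G) (∈-vecs z))

theorem2p2 : (n : ℕ) (G : Graph n) → IsCaterpillar G →
    2 * ∣ nonLeaves G ∣ + 6 ≤ n →
    (m : ℕ) (H : Graph m) → SameDeck G H → Isomorphic G H
theorem2p2 n G caterpillar large m H deck = go (sameDeck⇒sameOrder {G = G} {H} deck) H deck
  where
  3≤n : 3 ≤ n
  3≤n = ℕ.≤-trans (ℕ.≤-trans (s≤s (s≤s (s≤s z≤n))) (ℕ.m≤n+m 6 (2 * ∣ nonLeaves G ∣))) large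
  -- The bound on the spine says exactly that a card can hold `r + 4` vertices: a path on `r + 2`
  -- and two marks.
  size : ∀ r → 2 * r + 6 + 2 ≡ 2 * (4 + r)
  size = solve-∀
  x = caterpillar-path G caterpillar 3≤n
  go : ∀ {m} → n ≡ m → (H : Graph m) → SameDeck G H → Isomorphic G H
  go refl H deck = sameDeck⇒isomorphic {G = G} {H} deck (ℕ.≤-trans (s≤s z≤n) 3≤n)
    (subst (_≤ n + 2) (size ∣ nonLeaves G ∣) (ℕ.+-monoˡ-≤ 2 large))
    (proj₁ x) (proj₁ (proj₂ x)) (proj₂ (proj₂ x))
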